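{- The property $UN^=$ is undecidable for linear term rewrite systems that are right-flat and have left-hand sides of depth at most two. That is, there is no algorithm which, given a finite term rewrite system $R$ that is linear, all of whose right-hand sides are flat and all of whose left-hand sides have height at most two, decides whether $R$ is $UN^=$.
   Context: Terms are built from a finite signature $\mathcal{F}$ (function symbols with arities; arity-$0$ symbols are constants) and a countable set $X$ of variables disjoint from $\mathcal{F}$. The height (depth) of a constant or variable is $0$, and $\mathrm{height}(f(t_1,\dots,t_n))=1+\max_i \mathrm{height}(t_i)$ for $n>0$. A term is flat if its height is $0$ or $1$. A rewrite rule is a pair $l\to r$ of terms with $l\notin X$; it applies to a term by replacing a subterm of the form $l\sigma$ by $r\sigma$, $\sigma$ a substitution. A term rewrite system (TRS) is a finite set of rules. It is linear if in each rule every variable occurs at most once in the left-hand side and at most once in the right-hand side; it is right-flat if all right-hand sides are flat. $\overset{*}{\leftrightarrow}_R$ denotes the reflexive, symmetric, transitive closure of the one-step rewrite relation. A normal form is a term none of whose subterms can be rewritten. $R$ is $UN^=$ if there do not exist two distinct normal forms $M,N$ with $M\overset{*}{\leftrightarrow}_R N$. -}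

module Defs where

open import Data.Bool using (Bool; true; false)
open import Data.Fin using (Fin; toℕ)
open import Data.List using (List; []; _∷_; _++_; length; map; concatMap; replicate)
import Data.List as List
open import Data.List.Membership.Propositional using (_∈_)
open import Data.List.Relation.Unary.All using (All)
open import Data.Nat using (ℕ; zero; suc; _+_; _⊔_; _≤_; _≟_)
open import Data.Product using (∃₂; _×_)
open import Data.Vec using (Vec; []; _∷_; lookup; _[_]≔_)
open import Relation.Binary.Construct.Closure.Equivalence using (EqClosure)
open import Relation.Binary.PropositionalEquality using (_≡_; _≢_)
open import Relation.Nullary using (¬_; yes; no)

-- A finite signature is the list of the arities of its symbols; the symbols
-- themselves are the positions in this list.  The variables are the naturals.

Signature : Set
Signature = List ℕ

Symbol : Signature → Set
Symbol F = Fin (length F)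

arity : (F : Signature) → Symbol F → ℕ
arity F = List.lookup F

data Term (F : Signature) : Set where
  var  : ℕ → Term F
  node : (f : Symbol F) → Vec (Term F) (arity F f) → Term F

module _ {F : Signature} where

  mutual
    height : Term F → ℕ
    height (var x)     = 0
    height (node f ts) = height-node ts

    -- The height of a symbol applied to the given arguments.
    height-node : ∀ {n} → Vec (Term F) n → ℕ
    height-node []       = 0
    height-node (t ∷ ts) = suc (max-height (t ∷ ts))

    max-height : ∀ {n} → Vec (Term F) n → ℕ
    max-height []       = 0
    max-height (t ∷ ts) = height t ⊔ max-height ts

  Flat : Term F → Set
  Flat t = height t ≤ 1

  mutual
    occurrences : ℕ → Term F → ℕ
    occurrences x (var y) with x ≟ y
    ... | yes _ = 1
    ... | no  _ = 0
    occurrences x (node f ts) = occurrences* x ts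

    occurrences* : ∀ {n} → ℕ → Vec (Term F) n → ℕ
    occurrences* x []       = 0
    occurrences* x (t ∷ ts) = occurrences x t + occurrences* x ts

  mutual
    subst : (ℕ → Term F) → Term F → Term F
    subst σ (var x)     = σ x
    subst σ (node f ts) = node f (subst* σ ts)

    subst* : ∀ {n} → (ℕ → Term F) → Vec (Term F) n → Vec (Term F) n
    subst* σ []       = []
    subst* σ (t ∷ ts) = subst σ t ∷ subst* σ ts

-- Variables of the right-hand side need not occur in the left-hand side.

record Rule (F : Signature) : Set where
  constructor rule
  field
    lhs         : Term F
    rhs         : Term F
    lhs-not-var : ∀ x → lhs ≢ var x

open Rule public

record TRS : Set where
  constructor trs
  field
    signature : Signature
    rules     : List (Rule signature)

open TRS public

TermOf : TRS → Set
TermOf R = Term (signature R)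

data Step (R : TRS) : TermOf R → TermOf R → Set where
  root   : ∀ {ρ} → ρ ∈ rules R → (σ : ℕ → TermOf R) →
           Step R (subst σ (lhs ρ)) (subst σ (rhs ρ))
  inside : ∀ {f} (ts : Vec (TermOf R) (arity (signature R) f)) i {u} →
           Step R (lookup ts i) u →
           Step R (node f ts) (node f (ts [ i ]≔ u))

NormalForm : (R : TRS) → TermOf R → Set
NormalForm R t = ∀ u → ¬ Step R t u

Convertible : (R : TRS) → TermOf R → TermOf R → Set
Convertible R = EqClosure (Step R)

UN⁼ : TRS → Set
UN⁼ R = ¬ (∃₂ λ M N → NormalForm R M × NormalForm R N × M ≢ N × Convertible R M N)

Linear : TRS → Set
Linear R = All (λ ρ → ∀ x → occurrences x (lhs ρ) ≤ 1 × occurrences x (rhs ρ) ≤ 1) (rules R)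

RightFlat : TRS → Set
RightFlat R = All (λ ρ → Flat (rhs ρ)) (rules R)

LeftHeight≤ : ℕ → TRS → Set
LeftHeight≤ n R = All (λ ρ → height (lhs ρ) ≤ n) (rules R)

-- A TRS is written as a word: the arities of its symbols, then its rules, each
-- one being 𝐫 followed by its two sides in prefix notation.  A number n is
-- written in unary as 𝟏ⁿ𝐞.  Arities determine where each term ends, so the word
-- determines the signature and the list of the two sides of the rules.

data Letter : Set where
  𝟏 𝐞 𝐯 𝐟 𝐫 : Letter

encode-ℕ : ℕ → List Letter
encode-ℕ n = replicate n 𝟏 ++ 𝐞 ∷ []

module _ {F : Signature} where

  mutual
    encode-Term : Term F → List Letter
    encode-Term (var x)     = 𝐯 ∷ encode-ℕ x
    encode-Term (node f ts) = 𝐟 ∷ encode-ℕ (toℕ f) ++ encode-Terms ts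

    encode-Terms : ∀ {n} → Vec (Term F) n → List Letter
    encode-Terms []       = []
    encode-Terms (t ∷ ts) = encode-Term t ++ encode-Terms ts

  encode-Rule : Rule F → List Letter
  encode-Rule ρ = 𝐫 ∷ encode-Term (lhs ρ) ++ encode-Term (rhs ρ)

encode : TRS → List Letter
encode R = concatMap encode-ℕ (signature R) ++ concatMap encode-Rule (rules R)

-- Deterministic Turing machines with one two-way infinite tape and input
-- alphabet Letter.  Halting yields an answer: true accepts, false rejects.

data TapeSymbol (m : ℕ) : Set where
  blank  : TapeSymbol m
  letter : Letter → TapeSymbol m
  aux    : Fin m → TapeSymbol m

data Direction : Set where
  left right : Direction

data Action (n m : ℕ) : Set where
  halt : Bool → Action n m
  go   : Fin n → TapeSymbol m → Direction → Action n m

record TuringMachine : Set where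
  field
    #states : ℕ
    #aux    : ℕ
    start   : Fin #states
    δ       : Fin #states → TapeSymbol #aux → Action #states #aux

-- The cells to the left and to the right of the head are listed starting from
-- the head; all cells beyond the end of a list are blank.

record Tape (m : ℕ) : Set where
  constructor tape
  field
    lefts  : List (TapeSymbol m)
    head   : TapeSymbol m
    rights : List (TapeSymbol m)

open Tape public using (head)

write-move : ∀ {m} → TapeSymbol m → Direction → Tape m → Tape m
write-move s left  (tape []       _ rs)       = tape [] blank (s ∷ rs)
write-move s left  (tape (l ∷ ls) _ rs)       = tape ls l (s ∷ rs)
write-move s right (tape ls       _ [])       = tape (s ∷ ls) blank []
write-move s right (tape ls       _ (r ∷ rs)) = tape (s ∷ ls) r rs

input : ∀ {m} → List Letter → Tape m
input []      = tape [] blank []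
input (a ∷ w) = tape [] (letter a) (map letter w)

module _ (M : TuringMachine) where
  open TuringMachine M

  data HaltsFrom : Fin #states → Tape #aux → Bool → Set where
    stop : ∀ {q t b} → δ q (head t) ≡ halt b → HaltsFrom q t b
    step : ∀ {q t q′ s d b} → δ q (head t) ≡ go q′ s d →
           HaltsFrom q′ (write-move s d t) b → HaltsFrom q t b

  Answers : List Letter → Bool → Set
  Answers w b = HaltsFrom start (input w) b

  DecidesOn : List Letter → Set → Set
  DecidesOn w P = (P → Answers w true) × (¬ P → Answers w false)

{-# OPTIONS --safe #-}
module Submission where

-- A conversion uses rules in both directions, so an equation l = r between linear
-- terms of height at most two in x₀, x₁, x₂ may be imposed by the right-flat rules
-- l → j(x₀,x₁,x₂) and r → j(x₀,x₁,x₂), where j is a fresh "joint" symbol.  Loops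
-- f(x₀,…) → f(x₀,…) leave only the variables and two constants, initial and
-- accepted, as normal forms; the system is UN⁼ unless these two are convertible.
--
-- Given a machine M, the equations simulate M: run q s (l, r) is a configuration,
-- with the cells l and r beside the head, and load d q (l, r) is one whose scanned
-- cell still has to be taken from the side d.  The constant initial is convertible
-- to the start of M on the word self, and halting configurations that accept are
-- convertible to accepted.  The word self is the encoding of the system itself: the
-- system quotes the encoding w of its fixed part by a chain of constants cⱼ with
-- rules cⱼ → aⱼ(cⱼ₊₁), and computes its full encoding from w by copying the
-- arities, inserting the arities of the constants, copying the rules (from the first
-- 𝐫 on) and writing down the rules of the chain.
--
-- If M accepts the encoding, the simulation converts initial to accepted.  Conversely
-- the equations hold in a model where a term denotes a word and a proposition, a
-- configuration denoting the proposition that M accepts from it; so a conversion of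
-- initial to accepted forces M to accept.  Hence M does not decide UN⁼ of the system.

open import Defs
open import Data.Bool using (Bool; true; false; T; not; _∧_)
open import Data.Bool.Properties using (T-∧)
open import Data.Empty using (⊥; ⊥-elim)
open import Data.Fin using (Fin; zero; suc; toℕ; inject₁; #_)
open import Data.Fin.Properties using (toℕ-inject₁)
open import Data.List using (List; []; _∷_; _++_; length; map; concat; concatMap; replicate; drop)
open import Data.List using (allFin; cartesianProductWith)
import Data.List as List
open import Data.List.Membership.Propositional using (_∈_)
open import Data.List.Membership.Propositional.Properties using (∈-map⁺; ∈-++⁺ˡ; ∈-++⁺ʳ; ∈-concat⁺′)
open import Data.List.Membership.Propositional.Properties using (∈-lookup; ∈-allFin; ∈-cartesianProductWith⁺)
import Data.List.Properties as Listₚ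
import Data.List.Relation.Binary.Pointwise as Pw
open import Data.List.Relation.Unary.All using (All; []; _∷_)
import Data.List.Relation.Unary.All as All
import Data.List.Relation.Unary.All.Properties as Allₚ
open import Data.List.Relation.Unary.Any using (here; there; index)
open import Data.List.Relation.Unary.Any.Properties using (lookup-index)
open import Data.Maybe using (Maybe; just; nothing)
open import Data.Nat using (ℕ; zero; suc; _+_; _⊔_; _≤_; _<_; _≤ᵇ_; _≟_; z≤n; s≤s)
import Data.Nat.Properties as ℕₚ
open import Data.Product using (Σ; ∃; _×_; _,_; proj₁; proj₂)
open import Data.Sum using (_⊎_; inj₁; inj₂)
open import Data.Unit using (⊤; tt)
open import Data.Vec using (Vec; []; _∷_; lookup; _[_]≔_)
open import Data.Vec.Relation.Binary.Pointwise.Inductive using (Pointwise; []; _∷_)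
open import Function using (_∘_; id)
open import Function.Bundles using (Equivalence)
open import Relation.Binary using (IsEquivalence)
import Relation.Binary.Construct.Closure.Equivalence as EqClosure
open import Relation.Binary.PropositionalEquality using (_≡_; _≢_; refl; sym; trans; cong; cong₂; module ≡-Reasoning)
open import Relation.Binary.PropositionalEquality using () renaming (subst to ≡-subst; subst₂ to ≡-subst₂; setoid to ≡-setoid)
open import Relation.Nullary using (¬_; yes; no)
open ≡-Reasoning renaming (begin_ to begin-≡_)

-- Terms over a signature whose arities are known up to an equation.

module _ {F : Signature} where

  -- The arity is given up to a proof, so that lemmas follow by matching the proof with refl.
  apply : (f : Symbol F) → ∀ {n} → n ≡ arity F f → Vec (Term F) n → Term F
  apply f refl ts = node f ts

  variables : ℕ → ∀ n → Vec (Term F) n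
  variables i zero    = []
  variables i (suc n) = var i ∷ variables (suc i) n

  occurrences-variables-< : ∀ {x i} n → x < i → occurrences* x (variables i n) ≡ 0
  occurrences-variables-< zero x<i = refl
  occurrences-variables-< {x} {i} (suc n) x<i with x ≟ i
  ... | yes refl = ⊥-elim (ℕₚ.<-irrefl refl x<i)
  ... | no _     = occurrences-variables-< n (ℕₚ.m<n⇒m<1+n x<i)

  occurrences-variables : ∀ x i n → occurrences* x (variables i n) ≤ 1
  occurrences-variables x i zero = z≤n
  occurrences-variables x i (suc n) with x ≟ i
  ... | yes refl = s≤s (ℕₚ.≤-reflexive (occurrences-variables-< n ℕₚ.≤-refl))
  ... | no _     = occurrences-variables x (suc i) n

  max-height-variables : ∀ i n → max-height (variables i n) ≡ 0
  max-height-variables i zero    = refl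
  max-height-variables i (suc n) = max-height-variables (suc i) n

  occurrences-apply : ∀ x f {n} (eq : n ≡ arity F f) ts →
                      occurrences x (apply f eq ts) ≡ occurrences* x ts
  occurrences-apply x f refl ts = refl

  height-apply : ∀ f {n} (eq : n ≡ arity F f) ts → height (apply f eq ts) ≡ height-node ts
  height-apply f refl ts = refl

  flat-variables : ∀ i n → height-node (variables i n) ≤ 1
  flat-variables i zero    = z≤n
  flat-variables i (suc n) = s≤s (ℕₚ.≤-reflexive (max-height-variables (suc i) n))

  subst-apply : ∀ σ f {n} (eq : n ≡ arity F f) ts →
                subst σ (apply f eq ts) ≡ apply f eq (subst* σ ts)
  subst-apply σ f refl ts = refl

  apply≢var : ∀ f {n} (eq : n ≡ arity F f) ts x → apply f eq ts ≢ var x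
  apply≢var f refl ts x ()

  encode-apply : ∀ f {n} (eq : n ≡ arity F f) ts →
                 encode-Term (apply f eq ts) ≡ 𝐟 ∷ encode-ℕ (toℕ f) ++ encode-Terms ts
  encode-apply f refl ts = refl

  assign : ∀ {n} → Vec (Term F) n → ℕ → Term F
  assign []       _       = var 0
  assign (t ∷ ts) zero    = t
  assign (t ∷ ts) (suc x) = assign ts x

  -- The offset `i` absorbs the shift of the variables as the recursion moves along the vector.
  subst-variables : ∀ σ i {n} (ts : Vec (Term F) n) → (∀ j → σ (j + i) ≡ assign ts j) →
                    subst* σ (variables i n) ≡ ts
  subst-variables σ i []       σ≗ = refl
  subst-variables σ i (t ∷ ts) σ≗ =
    cong₂ _∷_ (σ≗ 0) (subst-variables σ (suc i) ts λ j → trans (cong σ (ℕₚ.+-suc j i)) (σ≗ (suc j)))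

-- The equational program: simulation of the machine and printing of the encoding.

module Reduction (M : TuringMachine) where
  open TuringMachine M

  State = Fin #states
  Cell  = TapeSymbol #aux
  Word  = List Cell

  -- The stages of a program that prints the encoding. The variants with `⁺` and the stages that
  -- print a single letter split steps that would otherwise have a side of height above two.
  data Routine : Set where
    begin finish self copy-sig copy-sig⁺ pad copy-rules : Routine
    datum-rules datum-rule datum-lhs datum-lhs⁺ datum-rhs datum-word : Routine
    datum-arg datum-index datum-rhs-index datum-rhs-index⁺ last-rule : Routine

  -- `ones i` prints `i` strokes and then the rest of a chain rule. Eight values suffice, because
  -- the symbols of the letters stand at positions 3 to 7.
  data Head : Set where
    initial accepted nil : Head
    cell : Cell → Head
    ones : Fin 8 → Head
    fn   : Routine → Head
    load : Direction → State → Head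
    run  : State → Cell → Head

  head-arity : Head → ℕ
  head-arity initial  = 0
  head-arity accepted = 0
  head-arity nil      = 0
  head-arity (cell _) = 1
  head-arity (ones _) = 2
  head-arity (load _ _) = 2
  head-arity (run _ _)  = 2
  head-arity (fn begin)  = 0
  head-arity (fn finish) = 0
  head-arity (fn self)   = 0
  head-arity (fn copy-sig)   = 2
  head-arity (fn copy-sig⁺)  = 2
  head-arity (fn pad)        = 3
  head-arity (fn copy-rules) = 2
  head-arity (fn datum-rules) = 2
  head-arity (fn datum-rule)  = 2
  head-arity (fn datum-lhs)   = 3
  head-arity (fn datum-lhs⁺)  = 3
  head-arity (fn datum-rhs)   = 2
  head-arity (fn datum-word)  = 2
  head-arity (fn datum-arg)   = 2
  head-arity (fn datum-index) = 2
  head-arity (fn datum-rhs-index)  = 3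
  head-arity (fn datum-rhs-index⁺) = 3
  head-arity (fn last-rule) = 0

  -- quoted stands for c₀, the constant that begins the chain spelling the quoted word.
  data Pattern : Set where
    v      : Fin 3 → Pattern
    quoted : Pattern
    _$_    : (h : Head) → Vec Pattern (head-arity h) → Pattern

  -- A side has a symbol at its root, so both sides of an equation may serve as left-hand sides of
  -- rules.
  data Side : Set where
    _$_ : (h : Head) → Vec Pattern (head-arity h) → Side

  x y z : Pattern
  x = v (# 0)
  y = v (# 1)
  z = v (# 2)

  infixr 6 _▸_ _▹_
  infix 6 _$_

  _▸_ : Letter → Pattern → Pattern
  a ▸ t = cell (letter a) $ (t ∷ [])

  _▹_ : Letter → Pattern → Side
  a ▹ t = cell (letter a) $ (t ∷ [])

  end : Pattern
  end = nil $ []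

  data Law : Set where
    begin-law self-law copy-sig-𝟏 copy-sig-𝐞 copy-sig⁺-law copy-sig-𝐫 pad-end : Law
    copy-rules-end datum-rules-law datum-rule-law : Law
    datum-lhs-𝟏 datum-lhs⁺-law datum-lhs-end datum-rhs-law datum-word-end : Law
    last-rule-law ones-zero datum-arg-law datum-index-law : Law
    datum-rhs-index-𝟏 datum-rhs-index⁺-law datum-rhs-index-end : Law

  -- Numbers are unary words. `datum-lhs` and `datum-rhs-index` consume a number while printing it;
  -- their third argument collects the strokes, so that the number is available again afterwards.
  law : Law → Side × Side
  law begin-law = fn begin $ [] , load right start $ (end ∷ (fn self $ []) ∷ [])
  law self-law  = fn self $ [] , fn copy-sig $ (quoted ∷ end ∷ [])
  law copy-sig-𝟏 = fn copy-sig $ (𝟏 ▸ x ∷ y ∷ []) , 𝟏 ▹ (fn copy-sig $ (x ∷ y ∷ []))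
  law copy-sig-𝐞 = fn copy-sig $ (𝐞 ▸ x ∷ y ∷ []) , 𝐞 ▹ (fn copy-sig⁺ $ (x ∷ y ∷ []))
  law copy-sig⁺-law = fn copy-sig⁺ $ (x ∷ y ∷ []) , fn copy-sig $ (x ∷ 𝟏 ▸ y ∷ [])
  -- y counts the arities copied, including that of c₀; one less is the position of c₀.
  law copy-sig-𝐫 = fn copy-sig $ (𝐫 ▸ x ∷ 𝟏 ▸ y ∷ []) , fn pad $ (x ∷ quoted ∷ y ∷ [])
  -- The `𝐫` consumed by `copy-sig-𝐫` is put back after the inserted arities.
  law pad-end = fn pad $ (x ∷ end ∷ z ∷ []) , 𝐫 ▹ (fn copy-rules $ (x ∷ z ∷ []))
  -- A linear law cannot duplicate a variable; the constant c₀ supplies a fresh copy of the quoted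
  -- word instead.
  law copy-rules-end = fn copy-rules $ (end ∷ y ∷ []) , fn datum-rules $ (quoted ∷ y ∷ [])
  law datum-rules-law = fn datum-rules $ (x ∷ y ∷ []) , 𝐫 ▹ (fn datum-rule $ (x ∷ y ∷ []))
  law datum-rule-law = fn datum-rule $ (x ∷ y ∷ []) , 𝐟 ▹ (fn datum-lhs $ (x ∷ y ∷ end ∷ []))
  law datum-lhs-𝟏 = fn datum-lhs $ (x ∷ 𝟏 ▸ y ∷ z ∷ []) , 𝟏 ▹ (fn datum-lhs⁺ $ (x ∷ y ∷ z ∷ []))
  law datum-lhs⁺-law = fn datum-lhs⁺ $ (x ∷ y ∷ z ∷ []) , fn datum-lhs $ (x ∷ y ∷ 𝟏 ▸ z ∷ [])
  law datum-lhs-end = fn datum-lhs $ (x ∷ end ∷ z ∷ []) , 𝐞 ▹ (fn datum-rhs $ (x ∷ z ∷ []))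
  law datum-rhs-law = fn datum-rhs $ (x ∷ y ∷ []) , 𝐟 ▹ (fn datum-word $ (x ∷ y ∷ []))
  -- The last constant of the chain goes to `nil`, which is at position 2 and is spelled with two
  -- strokes and `𝐞`.
  law datum-word-end = fn datum-word $ (end ∷ y ∷ []) , 𝟏 ▹ (fn last-rule $ [])
  law last-rule-law = fn last-rule $ [] , 𝟏 ▹ (𝐞 ▸ end)
  law ones-zero = ones zero $ (x ∷ y ∷ []) , 𝐞 ▹ (fn datum-arg $ (x ∷ y ∷ []))
  law datum-arg-law = fn datum-arg $ (x ∷ y ∷ []) , 𝐟 ▹ (fn datum-index $ (x ∷ y ∷ []))
  -- The argument of the letter is the next constant of the chain, hence the additional stroke.
  law datum-index-law = fn datum-index $ (x ∷ y ∷ []) , fn datum-rhs-index $ (x ∷ 𝟏 ▸ y ∷ end ∷ [])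
  law datum-rhs-index-𝟏 =
    fn datum-rhs-index $ (x ∷ 𝟏 ▸ y ∷ z ∷ []) , 𝟏 ▹ (fn datum-rhs-index⁺ $ (x ∷ y ∷ z ∷ []))
  law datum-rhs-index⁺-law =
    fn datum-rhs-index⁺ $ (x ∷ y ∷ z ∷ []) , fn datum-rhs-index $ (x ∷ y ∷ 𝟏 ▸ z ∷ [])
  law datum-rhs-index-end =
    fn datum-rhs-index $ (x ∷ end ∷ z ∷ []) , 𝐞 ▹ (fn datum-rules $ (x ∷ z ∷ []))

  data Equation : Set where
    read       : Direction → State → Cell → Equation
    read-blank : Direction → State → Equation
    act        : State → Cell → Equation
    pad-cell copy-rules-cell datum-word-cell : Letter → Equation
    ones-suc   : Fin 7 → Equation
    static     : Law → Equation

  -- The position of the symbol for a letter in ops below.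
  code : Letter → Fin 8
  code 𝟏 = # 3
  code 𝐞 = # 4
  code 𝐯 = # 5
  code 𝐟 = # 6
  code 𝐫 = # 7

  reaction : State → Cell → Action #states #aux → Side
  reaction q s (halt true)     = fn finish $ []
  -- A rejecting configuration is equated with itself, which imposes nothing.
  reaction q s (halt false)    = run q s $ (x ∷ y ∷ [])
  reaction q s (go q′ b left)  = load left q′ $ (x ∷ (cell b $ (y ∷ [])) ∷ [])
  reaction q s (go q′ b right) = load right q′ $ ((cell b $ (x ∷ [])) ∷ y ∷ [])

  equation : Equation → Side × Side
  equation (read left q s)  = load left q $ ((cell s $ (x ∷ [])) ∷ y ∷ []) , run q s $ (x ∷ y ∷ [])
  equation (read right q s) = load right q $ (x ∷ (cell s $ (y ∷ [])) ∷ []) , run q s $ (x ∷ y ∷ [])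
  equation (read-blank left q)  = load left q $ (end ∷ y ∷ []) , run q blank $ (end ∷ y ∷ [])
  equation (read-blank right q) = load right q $ (x ∷ end ∷ []) , run q blank $ (x ∷ end ∷ [])
  equation (act q s) = run q s $ (x ∷ y ∷ []) , reaction q s (δ q s)
  equation (pad-cell a) = fn pad $ (x ∷ a ▸ y ∷ z ∷ []) , 𝐞 ▹ (fn pad $ (x ∷ y ∷ z ∷ []))
  equation (copy-rules-cell a) = fn copy-rules $ (a ▸ x ∷ y ∷ []) , a ▹ (fn copy-rules $ (x ∷ y ∷ []))
  equation (datum-word-cell a) = fn datum-word $ (a ▸ x ∷ y ∷ []) , ones (code a) $ (x ∷ y ∷ [])
  equation (ones-suc k) = ones (suc k) $ (x ∷ y ∷ []) , 𝟏 ▹ (ones (inject₁ k) $ (x ∷ y ∷ []))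
  equation (static l) = law l

  -- Enumerations

  laws : List Law
  laws = begin-law ∷ self-law ∷ copy-sig-𝟏 ∷ copy-sig-𝐞 ∷ copy-sig⁺-law ∷ copy-sig-𝐫 ∷ pad-end ∷
         copy-rules-end ∷ datum-rules-law ∷ datum-rule-law ∷
         datum-lhs-𝟏 ∷ datum-lhs⁺-law ∷ datum-lhs-end ∷ datum-rhs-law ∷ datum-word-end ∷
         last-rule-law ∷ ones-zero ∷ datum-arg-law ∷ datum-index-law ∷
         datum-rhs-index-𝟏 ∷ datum-rhs-index⁺-law ∷ datum-rhs-index-end ∷ []

  ∈-laws : ∀ l → l ∈ laws
  ∈-laws begin-law = ∈-lookup (# 0)
  ∈-laws self-law = ∈-lookup (# 1)
  ∈-laws copy-sig-𝟏 = ∈-lookup (# 2)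
  ∈-laws copy-sig-𝐞 = ∈-lookup (# 3)
  ∈-laws copy-sig⁺-law = ∈-lookup (# 4)
  ∈-laws copy-sig-𝐫 = ∈-lookup (# 5)
  ∈-laws pad-end = ∈-lookup (# 6)
  ∈-laws copy-rules-end = ∈-lookup (# 7)
  ∈-laws datum-rules-law = ∈-lookup (# 8)
  ∈-laws datum-rule-law = ∈-lookup (# 9)
  ∈-laws datum-lhs-𝟏 = ∈-lookup (# 10)
  ∈-laws datum-lhs⁺-law = ∈-lookup (# 11)
  ∈-laws datum-lhs-end = ∈-lookup (# 12)
  ∈-laws datum-rhs-law = ∈-lookup (# 13)
  ∈-laws datum-word-end = ∈-lookup (# 14)
  ∈-laws last-rule-law = ∈-lookup (# 15)
  ∈-laws ones-zero = ∈-lookup (# 16)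
  ∈-laws datum-arg-law = ∈-lookup (# 17)
  ∈-laws datum-index-law = ∈-lookup (# 18)
  ∈-laws datum-rhs-index-𝟏 = ∈-lookup (# 19)
  ∈-laws datum-rhs-index⁺-law = ∈-lookup (# 20)
  ∈-laws datum-rhs-index-end = ∈-lookup (# 21)

  routines : List Routine
  routines = begin ∷ finish ∷ self ∷ copy-sig ∷ copy-sig⁺ ∷ pad ∷ copy-rules ∷
             datum-rules ∷ datum-rule ∷ datum-lhs ∷ datum-lhs⁺ ∷ datum-rhs ∷ datum-word ∷
             datum-arg ∷ datum-index ∷ datum-rhs-index ∷ datum-rhs-index⁺ ∷ last-rule ∷ []

  ∈-routines : ∀ f → f ∈ routines
  ∈-routines begin = ∈-lookup (# 0)
  ∈-routines finish = ∈-lookup (# 1)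
  ∈-routines self = ∈-lookup (# 2)
  ∈-routines copy-sig = ∈-lookup (# 3)
  ∈-routines copy-sig⁺ = ∈-lookup (# 4)
  ∈-routines pad = ∈-lookup (# 5)
  ∈-routines copy-rules = ∈-lookup (# 6)
  ∈-routines datum-rules = ∈-lookup (# 7)
  ∈-routines datum-rule = ∈-lookup (# 8)
  ∈-routines datum-lhs = ∈-lookup (# 9)
  ∈-routines datum-lhs⁺ = ∈-lookup (# 10)
  ∈-routines datum-rhs = ∈-lookup (# 11)
  ∈-routines datum-word = ∈-lookup (# 12)
  ∈-routines datum-arg = ∈-lookup (# 13)
  ∈-routines datum-index = ∈-lookup (# 14)
  ∈-routines datum-rhs-index = ∈-lookup (# 15)
  ∈-routines datum-rhs-index⁺ = ∈-lookup (# 16)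
  ∈-routines last-rule = ∈-lookup (# 17)

  directions : List Direction
  directions = left ∷ right ∷ []

  ∈-directions : ∀ d → d ∈ directions
  ∈-directions left  = here refl
  ∈-directions right = there (here refl)

  letters : List Letter
  letters = 𝟏 ∷ 𝐞 ∷ 𝐯 ∷ 𝐟 ∷ 𝐫 ∷ []

  ∈-letters : ∀ a → a ∈ letters
  ∈-letters 𝟏 = ∈-lookup (# 0)
  ∈-letters 𝐞 = ∈-lookup (# 1)
  ∈-letters 𝐯 = ∈-lookup (# 2)
  ∈-letters 𝐟 = ∈-lookup (# 3)
  ∈-letters 𝐫 = ∈-lookup (# 4)

  cells : List Cell
  cells = map letter letters ++ blank ∷ map aux (allFin #aux)

  ∈-cells : ∀ s → s ∈ cells
  ∈-cells blank      = there (there (there (there (there (here refl)))))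
  ∈-cells (letter a) = ∈-++⁺ˡ (∈-map⁺ letter (∈-letters a))
  ∈-cells (aux i)    = ∈-++⁺ʳ (map letter letters) (there (∈-map⁺ aux (∈-allFin i)))

  scanned : {A : Set} → (State → Cell → A) → List A
  scanned f = cartesianProductWith f (allFin #states) cells

  ∈-scanned : {A : Set} (f : State → Cell → A) → ∀ q s → f q s ∈ scanned f
  ∈-scanned f q s = ∈-cartesianProductWith⁺ f (∈-allFin q) (∈-cells s)

  loaded : {A : Set} → (Direction → State → A) → List A
  loaded f = cartesianProductWith f directions (allFin #states)

  ∈-loaded : {A : Set} (f : Direction → State → A) → ∀ d q → f d q ∈ loaded f
  ∈-loaded f d q = ∈-cartesianProductWith⁺ f (∈-directions d) (∈-allFin q)

  opaque
    equation-families : List (List Equation)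
    equation-families =
      map static laws ∷ scanned (read left) ∷ scanned (read right) ∷ loaded read-blank ∷
      scanned act ∷ map pad-cell letters ∷ map copy-rules-cell letters ∷
      map datum-word-cell letters ∷ map ones-suc (allFin 7) ∷ []

    equations : List Equation
    equations = concat equation-families

    ∈-equation-family : ∀ {e} i → e ∈ List.lookup equation-families i → e ∈ equations
    ∈-equation-family i e∈ = ∈-concat⁺′ e∈ (∈-lookup {xs = equation-families} i)

    ∈-equations : ∀ e → e ∈ equations
    ∈-equations (static l)          = ∈-equation-family (# 0) (∈-map⁺ static (∈-laws l))
    ∈-equations (read left q s)     = ∈-equation-family (# 1) (∈-scanned (read left) q s)
    ∈-equations (read right q s)    = ∈-equation-family (# 2) (∈-scanned (read right) q s)
    ∈-equations (read-blank d q)    = ∈-equation-family (# 3) (∈-loaded read-blank d q)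
    ∈-equations (act q s)           = ∈-equation-family (# 4) (∈-scanned act q s)
    ∈-equations (pad-cell a)        = ∈-equation-family (# 5) (∈-map⁺ pad-cell (∈-letters a))
    ∈-equations (copy-rules-cell a) = ∈-equation-family (# 6) (∈-map⁺ copy-rules-cell (∈-letters a))
    ∈-equations (datum-word-cell a) = ∈-equation-family (# 7) (∈-map⁺ datum-word-cell (∈-letters a))
    ∈-equations (ones-suc k)        = ∈-equation-family (# 8) (∈-map⁺ ones-suc (∈-allFin k))

  -- Operations and their positions in the signature.

  data Op : Set where
    base  : Head → Op
    joint : Equation → Op

  op-arity : Op → ℕ
  op-arity (base h)  = head-arity h
  op-arity (joint _) = 3

  distinguished : Op → Bool
  distinguished (base initial)  = true
  distinguished (base accepted) = true
  distinguished _               = false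

  opaque
    -- The cells come right after `nil`, and the letters come first among the cells; so the
    -- positions of `nil` and of the letters are the same for every machine, as `code` and
    -- `datum-word-end` presuppose.
    op-families : List (List Op)
    op-families =
      map (base ∘ cell) cells ∷ map (base ∘ ones) (allFin 8) ∷ map (base ∘ fn) routines ∷
      loaded (λ d q → base (load d q)) ∷ scanned (λ q s → base (run q s)) ∷ map joint equations ∷ []

    other-ops : List Op
    other-ops = base nil ∷ concat op-families

    ∈-op-family : ∀ {o} i → o ∈ List.lookup op-families i → o ∈ other-ops
    ∈-op-family i o∈ = there (∈-concat⁺′ o∈ (∈-lookup {xs = op-families} i))

    ∈-other-ops : ∀ o → T (not (distinguished o)) → o ∈ other-ops
    ∈-other-ops (base nil)        _ = here refl
    ∈-other-ops (base (cell s))   _ = ∈-op-family (# 0) (∈-map⁺ (base ∘ cell) (∈-cells s))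
    ∈-other-ops (base (ones k))   _ = ∈-op-family (# 1) (∈-map⁺ (base ∘ ones) (∈-allFin k))
    ∈-other-ops (base (fn f))     _ = ∈-op-family (# 2) (∈-map⁺ (base ∘ fn) (∈-routines f))
    ∈-other-ops (base (load d q)) _ = ∈-op-family (# 3) (∈-loaded (λ d q → base (load d q)) d q)
    ∈-other-ops (base (run q s))  _ = ∈-op-family (# 4) (∈-scanned (λ q s → base (run q s)) q s)
    ∈-other-ops (joint e)         _ = ∈-op-family (# 5) (∈-map⁺ joint (∈-equations e))

    other-index-nil : toℕ (index (∈-other-ops (base nil) tt)) ≡ 0
    other-index-nil = refl

    other-index-cell : ∀ a → 2 + toℕ (index (∈-other-ops (base (cell (letter a))) tt)) ≡ toℕ (code a)
    other-index-cell 𝟏 = refl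
    other-index-cell 𝐞 = refl
    other-index-cell 𝐯 = refl
    other-index-cell 𝐟 = refl
    other-index-cell 𝐫 = refl

    scanned-all : {A : Set} {P : A → Set} (f : State → Cell → A) → (∀ q s → P (f q s)) → All P (scanned f)
    scanned-all f p =
      Allₚ.cartesianProductWith⁺ (≡-setoid _) (≡-setoid _) f (allFin #states) cells λ _ _ → p _ _

    loaded-all : {A : Set} {P : A → Set} (f : Direction → State → A) → (∀ d q → P (f d q)) → All P (loaded f)
    loaded-all f p =
      Allₚ.cartesianProductWith⁺ (≡-setoid _) (≡-setoid _) f directions (allFin #states) λ _ _ → p _ _

    map-all : {A : Set} {P : Op → Set} (f : A → Op) → (∀ a → P (f a)) → ∀ as → All P (map f as)
    map-all f p as = Allₚ.map⁺ (All.universal p as)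

    other-ops-undistinguished : All (λ o → distinguished o ≡ false) other-ops
    other-ops-undistinguished =
      refl ∷ Allₚ.concat⁺ {xss = op-families}
        ( map-all (base ∘ cell) (λ _ → refl) cells
        ∷ map-all (base ∘ ones) (λ _ → refl) (allFin 8)
        ∷ map-all (base ∘ fn) (λ _ → refl) routines
        ∷ loaded-all (λ d q → base (load d q)) (λ _ _ → refl)
        ∷ scanned-all (λ q s → base (run q s)) (λ _ _ → refl)
        ∷ map-all joint (λ _ → refl) equations ∷ [])

  ops : List Op
  ops = base initial ∷ base accepted ∷ other-ops

  ∈-ops : ∀ o → o ∈ ops
  ∈-ops (base initial)      = here refl
  ∈-ops (base accepted)     = there (here refl)
  ∈-ops (base nil)          = there (there (∈-other-ops (base nil) tt))
  ∈-ops (base (cell s))     = there (there (∈-other-ops (base (cell s)) tt))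
  ∈-ops (base (ones k))     = there (there (∈-other-ops (base (ones k)) tt))
  ∈-ops (base (fn f))       = there (there (∈-other-ops (base (fn f)) tt))
  ∈-ops (base (load d q))   = there (there (∈-other-ops (base (load d q)) tt))
  ∈-ops (base (run q s))    = there (there (∈-other-ops (base (run q s)) tt))
  ∈-ops (joint e)           = there (there (∈-other-ops (joint e) tt))

  op-index : Op → Fin (length ops)
  op-index o = index (∈-ops o)

  -- Rules

  -- The constants c₀ to cₖ of the chain come last, so that the positions of c₀ and of all
  -- operations are independent of `k`.
  signature-of : ℕ → Signature
  signature-of k = map op-arity ops ++ replicate (suc k) 0

  Trm : ℕ → Set
  Trm k = Term (signature-of k)

  op-symbol : ∀ {k} os → Fin (length os) → Fin (length (map op-arity os ++ replicate (suc k) 0))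
  op-symbol (o ∷ os) zero    = zero
  op-symbol (o ∷ os) (suc i) = suc (op-symbol os i)

  -- Indices beyond k are clamped to k.
  constant : ∀ k → ℕ → Fin (length (replicate (suc k) 0))
  constant k       zero    = zero
  constant zero    (suc j) = zero
  constant (suc k) (suc j) = suc (constant k j)

  datum-symbol : ∀ {k} os → ℕ → Fin (length (map op-arity os ++ replicate (suc k) 0))
  datum-symbol {k} []       j = constant k j
  datum-symbol     (o ∷ os) j = suc (datum-symbol os j)

  arity-op-symbol : ∀ {k} os i →
    op-arity (List.lookup os i) ≡ List.lookup (map op-arity os ++ replicate (suc k) 0) (op-symbol os i)
  arity-op-symbol (o ∷ os) zero    = refl
  arity-op-symbol (o ∷ os) (suc i) = arity-op-symbol os i

  arity-constant : ∀ k j → 0 ≡ List.lookup (replicate (suc k) 0) (constant k j)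
  arity-constant k       zero    = refl
  arity-constant zero    (suc j) = refl
  arity-constant (suc k) (suc j) = arity-constant k j

  arity-datum-symbol : ∀ {k} os j →
    0 ≡ List.lookup (map op-arity os ++ replicate (suc k) 0) (datum-symbol os j)
  arity-datum-symbol {k} []       j = arity-constant k j
  arity-datum-symbol     (o ∷ os) j = arity-datum-symbol os j

  toℕ-op-symbol : ∀ {k} os i → toℕ (op-symbol {k} os i) ≡ toℕ i
  toℕ-op-symbol (o ∷ os) zero    = refl
  toℕ-op-symbol (o ∷ os) (suc i) = cong suc (toℕ-op-symbol os i)

  toℕ-constant : ∀ {k j} → j ≤ k → toℕ (constant k j) ≡ j
  toℕ-constant {k} z≤n   = refl
  toℕ-constant (s≤s j≤k) = cong suc (toℕ-constant j≤k)

  toℕ-datum-symbol : ∀ {k j} os → j ≤ k → toℕ (datum-symbol {k} os j) ≡ length os + j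
  toℕ-datum-symbol []       j≤k = toℕ-constant j≤k
  toℕ-datum-symbol (o ∷ os) j≤k = cong suc (toℕ-datum-symbol os j≤k)

  symbol : ∀ k → Op → Symbol (signature-of k)
  symbol k o = op-symbol ops (op-index o)

  arity-symbol : ∀ k o → op-arity o ≡ arity (signature-of k) (symbol k o)
  arity-symbol k o =
    trans (cong op-arity (lookup-index (∈-ops o))) (arity-op-symbol {k} ops (op-index o))

  op : ∀ {k} (o : Op) → Vec (Trm k) (op-arity o) → Trm k
  op {k} o = apply (symbol k o) (arity-symbol k o)

  datum : ∀ {k} → ℕ → Trm k
  datum {k} j = apply (datum-symbol ops j) (arity-datum-symbol {k} ops j) []

  mutual
    inst : ∀ {k} → Vec (Trm k) 3 → Pattern → Trm k
    inst σ (v i)    = lookup σ i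
    inst σ quoted   = datum 0
    inst σ (h $ ts) = op (base h) (inst* σ ts)

    inst* : ∀ {k n} → Vec (Trm k) 3 → Vec Pattern n → Vec (Trm k) n
    inst* σ []       = []
    inst* σ (t ∷ ts) = inst σ t ∷ inst* σ ts

  inst-side : ∀ {k} → Vec (Trm k) 3 → Side → Trm k
  inst-side σ (h $ ts) = op (base h) (inst* σ ts)

  -- Indexed by positions rather than by operations, so that every symbol gets its own loop whether
  -- or not the enumeration repeats an operation.
  loop-rule : ∀ k → Fin (length ops) → Rule (signature-of k)
  loop-rule k i = rule t t (apply≢var (op-symbol ops i) (arity-op-symbol {k} ops i) ts)
    where
    ts : Vec (Trm k) (op-arity (List.lookup ops i))
    ts = variables 0 _
    t = apply (op-symbol ops i) (arity-op-symbol {k} ops i) ts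

  -- The joint receives all three variables, even those that the side lacks; thus both sides of an
  -- equation reach the same term under every substitution.
  joint-rule : ∀ k → Equation → Side → Rule (signature-of k)
  joint-rule k e (h $ ts) =
    rule (op (base h) (inst* (variables 0 3) ts)) (op (joint e) (variables 0 3))
         (apply≢var (symbol k (base h)) (arity-symbol k (base h)) _)

  -- Separate rules, since an equation with a side initial or accepted would make it reducible.
  begin-rule finish-rule : ∀ k → Rule (signature-of k)
  begin-rule k =
    rule (op (base (fn begin)) []) (op (base initial) [])
         (apply≢var (symbol k (base (fn begin))) (arity-symbol k (base (fn begin))) [])
  finish-rule k =
    rule (op (base (fn finish)) []) (op (base accepted) [])
         (apply≢var (symbol k (base (fn finish))) (arity-symbol k (base (fn finish))) [])

  datum-rule-for : ∀ k → ℕ → Trm k → Rule (signature-of k)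
  datum-rule-for k j t =
    rule (datum j) t (apply≢var (datum-symbol ops j) (arity-datum-symbol {k} ops j) [])

  quotation : ∀ k → List Letter → ℕ → List (Rule (signature-of k))
  quotation k []      j = datum-rule-for k j (op (base nil) []) ∷ []
  quotation k (a ∷ w) j =
    datum-rule-for k j (op (base (cell (letter a))) (datum (suc j) ∷ [])) ∷ quotation k w (suc j)

  looping : ∀ k → Fin (length other-ops) → Rule (signature-of k)
  looping k i = loop-rule k (suc (suc i))

  left-rule right-rule : ∀ k → Equation → Rule (signature-of k)
  left-rule  k e = joint-rule k e (proj₁ (equation e))
  right-rule k e = joint-rule k e (proj₂ (equation e))

  base-rules : ∀ k → List (Rule (signature-of k))
  base-rules k =
    begin-rule k ∷ finish-rule k ∷ map (looping k) (allFin (length other-ops)) ++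
    map (left-rule k) equations ++ map (right-rule k) equations

  system : List Letter → TRS
  system w = trs (signature-of (length w)) (base-rules (length w) ++ quotation (length w) w 0)

  all-base-rules : ∀ {k} {P : Rule (signature-of k) → Set} → (∀ i → P (looping k i)) →
                   (∀ e → P (left-rule k e)) → (∀ e → P (right-rule k e)) →
                   P (begin-rule k) → P (finish-rule k) → All P (base-rules k)
  all-base-rules loops lefts rights b f =
    b ∷ f ∷ Allₚ.++⁺ (Allₚ.map⁺ (All.universal loops (allFin (length other-ops))))
      (Allₚ.++⁺ (Allₚ.map⁺ (All.universal lefts equations))
                (Allₚ.map⁺ (All.universal rights equations)))

  all-quotation : ∀ {k} {P : Rule (signature-of k) → Set} →
                  (∀ j → P (datum-rule-for k j (op (base nil) []))) →
                  (∀ a j → P (datum-rule-for k j (op (base (cell (letter a))) (datum (suc j) ∷ [])))) →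
                  ∀ w j → All P (quotation k w j)
  all-quotation last link []      j = last j ∷ []
  all-quotation last link (a ∷ w) j = link a j ∷ all-quotation last link w (suc j)

  -- Syntactic restrictions

  mutual
    pattern-height : Pattern → ℕ
    pattern-height (v i)    = 0
    pattern-height quoted   = 0
    pattern-height (h $ ts) = patterns-height ts

    patterns-height : ∀ {n} → Vec Pattern n → ℕ
    patterns-height []       = 0
    patterns-height (t ∷ ts) = suc (max-pattern-height (t ∷ ts))

    max-pattern-height : ∀ {n} → Vec Pattern n → ℕ
    max-pattern-height []       = 0
    max-pattern-height (t ∷ ts) = pattern-height t ⊔ max-pattern-height ts

  mutual
    pattern-occurrences : ℕ → Pattern → ℕ
    pattern-occurrences i (v j)    = occurrences {[]} i (var (toℕ j))
    pattern-occurrences i quoted   = 0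
    pattern-occurrences i (h $ ts) = pattern-occurrences* i ts

    pattern-occurrences* : ∀ {n} → ℕ → Vec Pattern n → ℕ
    pattern-occurrences* i []       = 0
    pattern-occurrences* i (t ∷ ts) = pattern-occurrences i t + pattern-occurrences* i ts

  -- A Boolean test, so that each concrete equation is checked by evaluation. Patterns contain only
  -- the variables 0, 1 and 2.
  arguments-ok : ∀ {n} → Vec Pattern n → Bool
  arguments-ok ts =
    (patterns-height ts ≤ᵇ 2) ∧ (pattern-occurrences* 0 ts ≤ᵇ 1) ∧
    (pattern-occurrences* 1 ts ≤ᵇ 1) ∧ (pattern-occurrences* 2 ts ≤ᵇ 1)

  side-ok : Side → Bool
  side-ok (h $ ts) = not (distinguished (base h)) ∧ arguments-ok ts

  reaction-ok : ∀ q s a → T (side-ok (reaction q s a))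
  reaction-ok q s (halt true)     = tt
  reaction-ok q s (halt false)    = tt
  reaction-ok q s (go q′ b left)  = tt
  reaction-ok q s (go q′ b right) = tt

  law-ok : ∀ l → T (side-ok (proj₁ (law l))) × T (side-ok (proj₂ (law l)))
  law-ok begin-law = tt , tt
  law-ok self-law = tt , tt
  law-ok copy-sig-𝟏 = tt , tt
  law-ok copy-sig-𝐞 = tt , tt
  law-ok copy-sig⁺-law = tt , tt
  law-ok copy-sig-𝐫 = tt , tt
  law-ok pad-end = tt , tt
  law-ok copy-rules-end = tt , tt
  law-ok datum-rules-law = tt , tt
  law-ok datum-rule-law = tt , tt
  law-ok datum-lhs-𝟏 = tt , tt
  law-ok datum-lhs⁺-law = tt , tt
  law-ok datum-lhs-end = tt , tt
  law-ok datum-rhs-law = tt , tt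
  law-ok datum-word-end = tt , tt
  law-ok last-rule-law = tt , tt
  law-ok ones-zero = tt , tt
  law-ok datum-arg-law = tt , tt
  law-ok datum-index-law = tt , tt
  law-ok datum-rhs-index-𝟏 = tt , tt
  law-ok datum-rhs-index⁺-law = tt , tt
  law-ok datum-rhs-index-end = tt , tt

  equation-ok : ∀ e → T (side-ok (proj₁ (equation e))) × T (side-ok (proj₂ (equation e)))
  equation-ok (read left q s)       = tt , tt
  equation-ok (read right q s)      = tt , tt
  equation-ok (read-blank left q)   = tt , tt
  equation-ok (read-blank right q)  = tt , tt
  equation-ok (act q s)             = tt , reaction-ok q s (δ q s)
  equation-ok (pad-cell a)          = tt , tt
  equation-ok (copy-rules-cell a)   = tt , tt
  equation-ok (datum-word-cell a)   = tt , tt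
  equation-ok (ones-suc k)          = tt , tt
  equation-ok (static l)            = law-ok l

  height-op : ∀ {k} o (ts : Vec (Trm k) (op-arity o)) → height (op o ts) ≡ height-node ts
  height-op {k} o = height-apply {F = signature-of k} (symbol k o) (arity-symbol k o)

  height-datum : ∀ {k} j → height (datum {k} j) ≡ 0
  height-datum {k} j =
    height-apply {F = signature-of k} (datum-symbol ops j) (arity-datum-symbol {k} ops j) []

  occurrences-op : ∀ {k} i o (ts : Vec (Trm k) (op-arity o)) →
                   occurrences i (op o ts) ≡ occurrences* i ts
  occurrences-op {k} i o = occurrences-apply {F = signature-of k} i (symbol k o) (arity-symbol k o)

  occurrences-datum : ∀ {k} i j → occurrences i (datum {k} j) ≡ 0
  occurrences-datum {k} i j =
    occurrences-apply {F = signature-of k} i (datum-symbol ops j) (arity-datum-symbol {k} ops j) []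

  module _ {k : ℕ} where

    vars : Vec (Trm k) 3
    vars = variables 0 3

    mutual
      height-inst : ∀ t → height (inst vars t) ≡ pattern-height t
      height-inst (v zero)             = refl
      height-inst (v (suc zero))       = refl
      height-inst (v (suc (suc zero))) = refl
      height-inst quoted   = height-datum 0
      height-inst (h $ ts) =
        trans (height-op (base h) (inst* vars ts)) (height-node-inst ts)

      height-node-inst : ∀ {n} (ts : Vec Pattern n) → height-node (inst* vars ts) ≡ patterns-height ts
      height-node-inst []       = refl
      height-node-inst (t ∷ ts) = cong suc (max-height-inst (t ∷ ts))

      max-height-inst : ∀ {n} (ts : Vec Pattern n) → max-height (inst* vars ts) ≡ max-pattern-height ts
      max-height-inst []       = refl
      max-height-inst (t ∷ ts) = cong₂ _⊔_ (height-inst t) (max-height-inst ts)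

    occurrences-var : ∀ i n → occurrences {signature-of k} i (var n) ≡ occurrences {[]} i (var n)
    occurrences-var i n with i ≟ n
    ... | yes _ = refl
    ... | no  _ = refl

    mutual
      occurrences-inst : ∀ i t → occurrences i (inst vars t) ≡ pattern-occurrences i t
      occurrences-inst i (v zero)             = occurrences-var i 0
      occurrences-inst i (v (suc zero))       = occurrences-var i 1
      occurrences-inst i (v (suc (suc zero))) = occurrences-var i 2
      occurrences-inst i quoted   = occurrences-datum i 0
      occurrences-inst i (h $ ts) =
        trans (occurrences-op i (base h) (inst* vars ts)) (occurrences-inst* i ts)

      occurrences-inst* : ∀ i {n} (ts : Vec Pattern n) →
                          occurrences* i (inst* vars ts) ≡ pattern-occurrences* i ts
      occurrences-inst* i []       = refl
      occurrences-inst* i (t ∷ ts) = cong₂ _+_ (occurrences-inst i t) (occurrences-inst* i ts)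

  mutual
    no-other-occurrences : ∀ i t → pattern-occurrences (3 + i) t ≡ 0
    no-other-occurrences i (v zero)             = refl
    no-other-occurrences i (v (suc zero))       = refl
    no-other-occurrences i (v (suc (suc zero))) = refl
    no-other-occurrences i quoted   = refl
    no-other-occurrences i (h $ ts) = no-other-occurrences* i ts

    no-other-occurrences* : ∀ i {n} (ts : Vec Pattern n) → pattern-occurrences* (3 + i) ts ≡ 0
    no-other-occurrences* i []       = refl
    no-other-occurrences* i (t ∷ ts) = cong₂ _+_ (no-other-occurrences i t) (no-other-occurrences* i ts)

  ∧-split : ∀ {a b} → T (a ∧ b) → T a × T b
  ∧-split = Equivalence.to T-∧

  arguments-height : ∀ {n} (ts : Vec Pattern n) → T (arguments-ok ts) → patterns-height ts ≤ 2
  arguments-height ts ok = ℕₚ.≤ᵇ⇒≤ _ _ (proj₁ (∧-split ok))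

  arguments-linear : ∀ {n} (ts : Vec Pattern n) → T (arguments-ok ts) →
                     ∀ i → pattern-occurrences* i ts ≤ 1
  arguments-linear ts ok i with ∧-split {patterns-height ts ≤ᵇ 2} ok
  ... | _ , ok′ with ∧-split {pattern-occurrences* 0 ts ≤ᵇ 1} ok′
  ... | ok₀ , ok″ with ∧-split {pattern-occurrences* 1 ts ≤ᵇ 1} ok″
  arguments-linear ts ok 0 | _ , _ | ok₀ , _ | _ , _ = ℕₚ.≤ᵇ⇒≤ _ _ ok₀
  arguments-linear ts ok 1 | _ , _ | _ , _ | ok₁ , _ = ℕₚ.≤ᵇ⇒≤ _ _ ok₁
  arguments-linear ts ok 2 | _ , _ | _ , _ | _ , ok₂ = ℕₚ.≤ᵇ⇒≤ _ _ ok₂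
  arguments-linear ts ok (suc (suc (suc i))) | _ | _ | _ =
    ℕₚ.≤-trans (ℕₚ.≤-reflexive (no-other-occurrences* i ts)) z≤n

  Restricted : ∀ {k} → Rule (signature-of k) → Set
  Restricted ρ = (∀ i → occurrences i (lhs ρ) ≤ 1 × occurrences i (rhs ρ) ≤ 1) ×
                 Flat (rhs ρ) × height (lhs ρ) ≤ 2

  ≤-via : ∀ {m n o} → m ≡ n → n ≤ o → m ≤ o
  ≤-via refl n≤o = n≤o

  op-linear : ∀ {k} o (ts : Vec (Trm k) (op-arity o)) i → occurrences* i ts ≤ 1 →
              occurrences i (op o ts) ≤ 1
  op-linear o ts i = ≤-via (occurrences-op i o ts)

  op-height : ∀ {k} o (ts : Vec (Trm k) (op-arity o)) {n} → height-node ts ≤ n → height (op o ts) ≤ n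
  op-height o ts = ≤-via (height-op o ts)

  looping-restricted : ∀ k i → Restricted (looping k i)
  looping-restricted k i =
    (λ j → linear j , linear j) , flat , ℕₚ.m≤n⇒m≤1+n flat
    where
    n = op-arity (List.lookup ops (suc (suc i)))
    f = op-symbol {k} ops (suc (suc i))
    eq = arity-op-symbol {k} ops (suc (suc i))
    linear = λ j → ≤-via (occurrences-apply {F = signature-of k} j f eq (variables 0 n))
                         (occurrences-variables {F = signature-of k} j 0 n)
    flat = ≤-via (height-apply {F = signature-of k} f eq (variables 0 n))
                 (flat-variables {F = signature-of k} 0 n)

  joint-restricted : ∀ k e s → T (side-ok s) → Restricted (joint-rule k e s)
  joint-restricted k e (h $ ts) ok =
    (λ i → op-linear {k} (base h) _ i (≤-via (occurrences-inst* i ts) (arguments-linear ts args-ok i)) ,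
           op-linear {k} (joint e) (variables 0 3) i (occurrences-variables {F = signature-of k} i 0 3)) ,
    op-height {k} (joint e) (variables 0 3) (flat-variables {F = signature-of k} 0 3) ,
    op-height {k} (base h) _ (≤-via (height-node-inst ts) (arguments-height ts args-ok))
    where args-ok = proj₂ (∧-split {not (distinguished (base h))} ok)

  begin-restricted : ∀ k → Restricted (begin-rule k)
  begin-restricted k =
    (λ i → op-linear {k} (base (fn begin)) [] i z≤n , op-linear {k} (base initial) [] i z≤n) ,
    op-height {k} (base initial) [] z≤n , op-height {k} (base (fn begin)) [] z≤n

  finish-restricted : ∀ k → Restricted (finish-rule k)
  finish-restricted k =
    (λ i → op-linear {k} (base (fn finish)) [] i z≤n , op-linear {k} (base accepted) [] i z≤n) ,
    op-height {k} (base accepted) [] z≤n , op-height {k} (base (fn finish)) [] z≤n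

  datum-rule-restricted : ∀ k j o (ts : Vec (Trm k) (op-arity o)) → (∀ i → occurrences* i ts ≤ 1) →
                          height-node ts ≤ 1 → Restricted (datum-rule-for k j (op o ts))
  datum-rule-restricted k j o ts linear flat =
    (λ i → ≤-via (occurrences-datum i j) z≤n , op-linear {k} o ts i (linear i)) ,
    op-height {k} o ts flat , ≤-via (height-datum j) z≤n

  system-restricted : ∀ w → All Restricted (rules (system w))
  system-restricted w =
    Allₚ.++⁺
      (all-base-rules (looping-restricted k)
        (λ e → joint-restricted k e (proj₁ (equation e)) (proj₁ (equation-ok e)))
        (λ e → joint-restricted k e (proj₂ (equation e)) (proj₂ (equation-ok e)))
        (begin-restricted k) (finish-restricted k))
      (all-quotation (λ j → datum-rule-restricted k j (base nil) [] (λ _ → z≤n) z≤n)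
        (λ a j → datum-rule-restricted k j (base (cell (letter a))) (datum (suc j) ∷ [])
          (λ i → ≤-via (cong (_+ 0) (occurrences-datum i (suc j))) z≤n)
          (s≤s (≤-via (cong (_⊔ 0) (height-datum (suc j))) z≤n)))
        w 0)
    where k = length w

  -- Model

  toWord : List Letter → Word
  toWord = map letter

  infixr 5 _^_◃_

  _^_◃_ : Letter → ℕ → Word → Word
  a ^ zero  ◃ u = u
  a ^ suc n ◃ u = letter a ∷ (a ^ n ◃ u)

  -- The tape denoted by a `load` term, whose scanned cell is still on one of the two sides.
  tape-at : Direction → Word → Word → Tape #aux
  tape-at left  []      r       = tape [] blank r
  tape-at left  (s ∷ l) r       = tape l s r
  tape-at right l       []      = tape l blank []
  tape-at right l       (s ∷ r) = tape l s r

  write-move-left : ∀ b l s r → write-move b left (tape l s r) ≡ tape-at left l (b ∷ r)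
  write-move-left b []      s r = refl
  write-move-left b (_ ∷ _) s r = refl

  write-move-right : ∀ b l s r → write-move b right (tape l s r) ≡ tape-at right (b ∷ l) r
  write-move-right b l s []      = refl
  write-move-right b l s (_ ∷ _) = refl

  mutual
    -- The encoding of the chain of rules that spells the given word, when its first constant is the
    -- symbol at position `n`.
    quotation-text : Word → ℕ → Word
    quotation-text u n = letter 𝐫 ∷ letter 𝐟 ∷ (𝟏 ^ n ◃ (letter 𝐞 ∷ letter 𝐟 ∷ rhs-text u n))

    rhs-text : Word → ℕ → Word
    rhs-text []             n = letter 𝟏 ∷ letter 𝟏 ∷ letter 𝐞 ∷ []
    rhs-text (letter a ∷ u) n = 𝟏 ^ toℕ (code a) ◃ datum-text u n
    -- Default value; quoted words consist of letters.
    rhs-text (_ ∷ u)        n = []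

    datum-text : Word → ℕ → Word
    datum-text u n =
      letter 𝐞 ∷ letter 𝐟 ∷ (𝟏 ^ suc n ◃ (letter 𝐞 ∷ quotation-text u (suc n)))

  module Model (w : List Letter) where

    k : ℕ
    k = length w

    R : TRS
    R = system w

    quoted-word : Word
    quoted-word = toWord w

    padded : Word → ℕ → ℕ → Word
    padded u m n = 𝐞 ^ m ◃ (letter 𝐫 ∷ u ++ quotation-text quoted-word n)

    copied : Word → ℕ → Word
    copied (letter 𝟏 ∷ u) n       = letter 𝟏 ∷ copied u n
    copied (letter 𝐞 ∷ u) n       = letter 𝐞 ∷ copied u (suc n)
    copied (letter 𝐫 ∷ u) (suc n) = padded u (length quoted-word) n
    -- Default value for words that are not arities followed by a rule.
    copied _              _       = []

    own-text : Word
    own-text = copied quoted-word 0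

    -- Arguments that stand for numbers are read by their length.
    routine-value : Routine → List Word → Word
    routine-value self _ = own-text
    routine-value copy-sig (a ∷ b ∷ _) = copied a (length b)
    routine-value copy-sig⁺ (a ∷ b ∷ _) = copied a (suc (length b))
    routine-value pad (a ∷ b ∷ c ∷ _) = padded a (length b) (length c)
    routine-value copy-rules (a ∷ b ∷ _) = a ++ quotation-text quoted-word (length b)
    routine-value datum-rules (a ∷ b ∷ _) = quotation-text a (length b)
    routine-value datum-rule (a ∷ b ∷ _) =
      letter 𝐟 ∷ (𝟏 ^ length b ◃ (letter 𝐞 ∷ letter 𝐟 ∷ rhs-text a (length b)))
    routine-value datum-lhs (a ∷ b ∷ c ∷ _) =
      𝟏 ^ length b ◃ (letter 𝐞 ∷ letter 𝐟 ∷ rhs-text a (length b + length c))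
    routine-value datum-lhs⁺ (a ∷ b ∷ c ∷ _) =
      𝟏 ^ length b ◃ (letter 𝐞 ∷ letter 𝐟 ∷ rhs-text a (length b + suc (length c)))
    routine-value datum-rhs (a ∷ b ∷ _) = letter 𝐟 ∷ rhs-text a (length b)
    routine-value datum-word (a ∷ b ∷ _) = rhs-text a (length b)
    routine-value datum-arg (a ∷ b ∷ _) =
      letter 𝐟 ∷ (𝟏 ^ suc (length b) ◃ (letter 𝐞 ∷ quotation-text a (suc (length b))))
    routine-value datum-index (a ∷ b ∷ _) =
      𝟏 ^ suc (length b) ◃ (letter 𝐞 ∷ quotation-text a (suc (length b)))
    routine-value datum-rhs-index (a ∷ b ∷ c ∷ _) =
      𝟏 ^ length b ◃ (letter 𝐞 ∷ quotation-text a (length b + length c))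
    routine-value datum-rhs-index⁺ (a ∷ b ∷ c ∷ _) =
      𝟏 ^ length b ◃ (letter 𝐞 ∷ quotation-text a (length b + suc (length c)))
    routine-value last-rule _ = letter 𝟏 ∷ letter 𝐞 ∷ []
    routine-value _ _ = []

    head-value : Head → List Word → Word
    head-value (cell s) (a ∷ _)     = s ∷ a
    head-value (ones i) (a ∷ b ∷ _) = 𝟏 ^ toℕ i ◃ datum-text a (length b)
    head-value (fn f)   as          = routine-value f as
    head-value _        _           = []

    Accepting : State → Tape #aux → Set
    Accepting q t = HaltsFrom M q t true

    head-holds : Head → List Word → Set
    head-holds initial     _           = Accepting start (tape-at right [] own-text)
    head-holds (fn begin)  _           = Accepting start (tape-at right [] own-text)
    head-holds accepted    _           = ⊤
    head-holds (fn finish) _           = ⊤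
    head-holds (load d q)  (a ∷ b ∷ _) = Accepting q (tape-at d a b)
    head-holds (run q s)   (a ∷ b ∷ _) = Accepting q (tape a s b)
    head-holds _           _           = ⊥

    mutual
      evaluate : Vec Word 3 → Pattern → Word
      evaluate ρ (v i)    = lookup ρ i
      evaluate ρ quoted   = quoted-word
      evaluate ρ (h $ ts) = head-value h (evaluate* ρ ts)

      evaluate* : ∀ {n} → Vec Word 3 → Vec Pattern n → List Word
      evaluate* ρ []       = []
      evaluate* ρ (t ∷ ts) = evaluate ρ t ∷ evaluate* ρ ts

    side-value : Vec Word 3 → Side → Word
    side-value ρ (h $ ts) = head-value h (evaluate* ρ ts)

    side-holds : Vec Word 3 → Side → Set
    side-holds ρ (h $ ts) = head-holds h (evaluate* ρ ts)

    Sound : Side × Side → Set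
    Sound (l , r) = ∀ a b c → let ρ = a ∷ b ∷ c ∷ [] in
      side-value ρ l ≡ side-value ρ r × (side-holds ρ l → side-holds ρ r) × (side-holds ρ r → side-holds ρ l)

    reaction-value : ∀ q s α ρ → side-value ρ (reaction q s α) ≡ []
    reaction-value q s (halt true)     ρ = refl
    reaction-value q s (halt false)    ρ = refl
    reaction-value q s (go q′ b left)  ρ = refl
    reaction-value q s (go q′ b right) ρ = refl

    -- The passage from a configuration to its successor inverts an accepting run, which works
    -- because `δ` determines the action.
    reaction-holds : ∀ q s α → δ q s ≡ α → ∀ a b c → let ρ = a ∷ b ∷ c ∷ [] in
      (Accepting q (tape a s b) → side-holds ρ (reaction q s α)) ×
      (side-holds ρ (reaction q s α) → Accepting q (tape a s b))
    reaction-holds q s (halt true)  eq a b c = (λ _ → tt) , λ _ → stop eq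
    reaction-holds q s (halt false) eq a b c = id , id
    reaction-holds q s (go q′ t left) eq a b c = to , from
      where
      to : Accepting q (tape a s b) → Accepting q′ (tape-at left a (t ∷ b))
      to (stop eq′) with () ← trans (sym eq) eq′
      to (step eq′ h) with refl ← trans (sym eq) eq′ =
        ≡-subst (Accepting q′) (write-move-left t a s b) h
      from : Accepting q′ (tape-at left a (t ∷ b)) → Accepting q (tape a s b)
      from h = step eq (≡-subst (Accepting q′) (sym (write-move-left t a s b)) h)
    reaction-holds q s (go q′ t right) eq a b c = to , from
      where
      to : Accepting q (tape a s b) → Accepting q′ (tape-at right (t ∷ a) b)
      to (stop eq′) with () ← trans (sym eq) eq′
      to (step eq′ h) with refl ← trans (sym eq) eq′ =
        ≡-subst (Accepting q′) (write-move-right t a s b) h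
      from : Accepting q′ (tape-at right (t ∷ a) b) → Accepting q (tape a s b)
      from h = step eq (≡-subst (Accepting q′) (sym (write-move-right t a s b)) h)

    -- Most laws hold by evaluation; the exceptions rearrange the sum of the unprinted and the
    -- printed part of an index.
    law-sound : ∀ l → Sound (law l)
    law-sound begin-law a b c = refl , id , id
    law-sound self-law a b c = refl , id , id
    law-sound copy-sig-𝟏 a b c = refl , id , id
    law-sound copy-sig-𝐞 a b c = refl , id , id
    law-sound copy-sig⁺-law a b c = refl , id , id
    law-sound copy-sig-𝐫 a b c = refl , id , id
    law-sound pad-end a b c = refl , id , id
    law-sound copy-rules-end a b c = refl , id , id
    law-sound datum-rules-law a b c = refl , id , id
    law-sound datum-rule-law a b c =
      cong (λ n → letter 𝐟 ∷ (𝟏 ^ length b ◃ (letter 𝐞 ∷ letter 𝐟 ∷ rhs-text a n)))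
           (sym (ℕₚ.+-identityʳ (length b))) , id , id
    law-sound datum-lhs-𝟏 a b c =
      cong (λ n → letter 𝟏 ∷ (𝟏 ^ length b ◃ (letter 𝐞 ∷ letter 𝐟 ∷ rhs-text a n)))
           (sym (ℕₚ.+-suc (length b) (length c))) , id , id
    law-sound datum-lhs⁺-law a b c = refl , id , id
    law-sound datum-lhs-end a b c = refl , id , id
    law-sound datum-rhs-law a b c = refl , id , id
    law-sound datum-word-end a b c = refl , id , id
    law-sound last-rule-law a b c = refl , id , id
    law-sound ones-zero a b c = refl , id , id
    law-sound datum-arg-law a b c = refl , id , id
    law-sound datum-index-law a b c =
      cong (λ n → 𝟏 ^ suc (length b) ◃ (letter 𝐞 ∷ quotation-text a n))
           (sym (ℕₚ.+-identityʳ (suc (length b)))) , id , id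
    law-sound datum-rhs-index-𝟏 a b c =
      cong (λ n → letter 𝟏 ∷ (𝟏 ^ length b ◃ (letter 𝐞 ∷ quotation-text a n)))
           (sym (ℕₚ.+-suc (length b) (length c))) , id , id
    law-sound datum-rhs-index⁺-law a b c = refl , id , id
    law-sound datum-rhs-index-end a b c = refl , id , id

    equation-sound : ∀ e → Sound (equation e)
    equation-sound (read left q s) a b c      = refl , id , id
    equation-sound (read right q s) a b c     = refl , id , id
    equation-sound (read-blank left q) a b c  = refl , id , id
    equation-sound (read-blank right q) a b c = refl , id , id
    equation-sound (act q s) a b c =
      sym (reaction-value q s (δ q s) (a ∷ b ∷ c ∷ [])) , reaction-holds q s (δ q s) refl a b c
    equation-sound (pad-cell _) a b c         = refl , id , id
    equation-sound (copy-rules-cell _) a b c  = refl , id , id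
    equation-sound (datum-word-cell _) a b c  = refl , id , id
    equation-sound (ones-suc i) a b c =
      cong (λ n → letter 𝟏 ∷ (𝟏 ^ n ◃ datum-text a (length b))) (sym (toℕ-inject₁ i)) , id , id
    equation-sound (static l) = law-sound l

    -- A joint takes the meaning of the left side of its equation, so that its left rule is sound by
    -- definition and its right rule by `equation-sound`.
    op-value : Op → List Word → Word
    op-value (base h)  as              = head-value h as
    op-value (joint e) (a ∷ b ∷ c ∷ _) = side-value (a ∷ b ∷ c ∷ []) (proj₁ (equation e))
    op-value (joint e) _               = []

    op-holds : Op → List Word → Set
    op-holds (base h)  as              = head-holds h as
    op-holds (joint e) (a ∷ b ∷ c ∷ _) = side-holds (a ∷ b ∷ c ∷ []) (proj₁ (equation e))
    op-holds (joint e) _               = ⊥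

    -- Interpretation of terms in the model.

    decode : ∀ os → Fin (length (map op-arity os ++ replicate (suc k) 0)) → Op ⊎ ℕ
    decode []       j       = inj₂ (toℕ j)
    decode (o ∷ os) zero    = inj₁ o
    decode (o ∷ os) (suc f) = decode os f

    decode-op-symbol : ∀ os i → decode os (op-symbol os i) ≡ inj₁ (List.lookup os i)
    decode-op-symbol (o ∷ os) zero    = refl
    decode-op-symbol (o ∷ os) (suc i) = decode-op-symbol os i

    decode-datum-symbol : ∀ os {j} → j ≤ k → decode os (datum-symbol os j) ≡ inj₂ j
    decode-datum-symbol []       j≤k = cong inj₂ (toℕ-constant j≤k)
    decode-datum-symbol (o ∷ os) j≤k = decode-datum-symbol os j≤k

    decode-symbol : ∀ o → decode ops (symbol k o) ≡ inj₁ o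
    decode-symbol o =
      trans (decode-op-symbol ops (op-index o)) (cong inj₁ (sym (lookup-index (∈-ops o))))

    symbol-value : Op ⊎ ℕ → List Word → Word
    symbol-value (inj₁ o) as = op-value o as
    symbol-value (inj₂ j) as = drop j quoted-word

    symbol-holds : Op ⊎ ℕ → List Word → Set
    symbol-holds (inj₁ o) as = op-holds o as
    symbol-holds (inj₂ j) as = ⊥

    mutual
      value : Trm k → Word
      value (var _)     = []
      value (node f ts) = symbol-value (decode ops f) (values ts)

      values : ∀ {n} → Vec (Trm k) n → List Word
      values []       = []
      values (t ∷ ts) = value t ∷ values ts

    holds : Trm k → Set
    holds (var _)     = ⊥
    holds (node f ts) = symbol-holds (decode ops f) (values ts)

    value-apply : ∀ f {n} (eq : n ≡ arity (signature-of k) f) ts →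
                  value (apply f eq ts) ≡ symbol-value (decode ops f) (values ts)
    value-apply f refl ts = refl

    holds-apply : ∀ f {n} (eq : n ≡ arity (signature-of k) f) ts →
                  holds (apply f eq ts) ≡ symbol-holds (decode ops f) (values ts)
    holds-apply f refl ts = refl

    value-op : ∀ o ts → value (op o ts) ≡ op-value o (values ts)
    value-op o ts =
      trans (value-apply (symbol k o) (arity-symbol k o) ts)
            (cong (λ m → symbol-value m (values ts)) (decode-symbol o))

    holds-op : ∀ o ts → holds (op o ts) ≡ op-holds o (values ts)
    holds-op o ts =
      trans (holds-apply (symbol k o) (arity-symbol k o) ts)
            (cong (λ m → symbol-holds m (values ts)) (decode-symbol o))

    value-datum : ∀ {j} → j ≤ k → value (datum j) ≡ drop j quoted-word
    value-datum {j} j≤k =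
      trans (value-apply (datum-symbol ops j) (arity-datum-symbol {k} ops j) [])
            (cong (λ m → symbol-value m []) (decode-datum-symbol ops j≤k))

    holds-datum : ∀ {j} → j ≤ k → holds (datum j) ≡ ⊥
    holds-datum {j} j≤k =
      trans (holds-apply (datum-symbol ops j) (arity-datum-symbol {k} ops j) [])
            (cong (λ m → symbol-holds m []) (decode-datum-symbol ops j≤k))

    triple : (ℕ → Trm k) → Vec (Trm k) 3
    triple σ = σ 0 ∷ σ 1 ∷ σ 2 ∷ []

    values₃ : (ℕ → Trm k) → Vec Word 3
    values₃ σ = value (σ 0) ∷ value (σ 1) ∷ value (σ 2) ∷ []

    mutual
      value-inst : ∀ σ t → value (inst (triple σ) t) ≡ evaluate (values₃ σ) t
      value-inst σ (v zero)             = refl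
      value-inst σ (v (suc zero))       = refl
      value-inst σ (v (suc (suc zero))) = refl
      value-inst σ quoted   = value-datum z≤n
      value-inst σ (h $ ts) =
        trans (value-op (base h) (inst* (triple σ) ts)) (cong (head-value h) (values-inst* σ ts))

      values-inst* : ∀ σ {n} (ts : Vec Pattern n) →
                     values (inst* (triple σ) ts) ≡ evaluate* (values₃ σ) ts
      values-inst* σ []       = refl
      values-inst* σ (t ∷ ts) = cong₂ _∷_ (value-inst σ t) (values-inst* σ ts)

    subst-op : ∀ σ o ts → subst σ (op o ts) ≡ op o (subst* σ ts)
    subst-op σ o ts = subst-apply {F = signature-of k} σ (symbol k o) (arity-symbol k o) ts

    subst-datum : ∀ σ j → subst σ (datum j) ≡ datum j
    subst-datum σ j =
      subst-apply {F = signature-of k} σ (datum-symbol ops j) (arity-datum-symbol {k} ops j) []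

    mutual
      subst-inst : ∀ σ t → subst σ (inst vars t) ≡ inst (triple σ) t
      subst-inst σ (v zero)             = refl
      subst-inst σ (v (suc zero))       = refl
      subst-inst σ (v (suc (suc zero))) = refl
      subst-inst σ quoted   = subst-datum σ 0
      subst-inst σ (h $ ts) = trans (subst-op σ (base h) _) (cong (op (base h)) (subst-inst* σ ts))

      subst-inst* : ∀ σ {n} (ts : Vec Pattern n) → subst* σ (inst* vars ts) ≡ inst* (triple σ) ts
      subst-inst* σ []       = refl
      subst-inst* σ (t ∷ ts) = cong₂ _∷_ (subst-inst σ t) (subst-inst* σ ts)

    -- An invariant of conversion.

    variable-of : Trm k → Maybe ℕ
    variable-of (var i)    = just i
    variable-of (node _ _) = nothing

    variable-of-apply : ∀ f {n} (eq : n ≡ arity (signature-of k) f) ts →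
                        variable-of (apply f eq ts) ≡ nothing
    variable-of-apply f refl ts = refl

    distinguished-symbol : Op ⊎ ℕ → Bool
    distinguished-symbol (inj₁ o) = distinguished o
    distinguished-symbol (inj₂ _) = false

    distinguished-term : Trm k → Bool
    distinguished-term (var _)     = false
    distinguished-term (node f ts) = distinguished-symbol (decode ops f)

    distinguished-apply : ∀ f {n} (eq : n ≡ arity (signature-of k) f) ts →
      distinguished-term (apply f eq ts) ≡ distinguished-symbol (decode ops f)
    distinguished-apply f refl ts = refl

    -- Variables are normal forms without any content in the model; the first component keeps them
    -- apart from each other and from all other terms.
    record _≋_ (t u : Trm k) : Set where
      constructor same
      field
        ≋-variable : variable-of t ≡ variable-of u
        ≋-value    : value t ≡ value u
        ≋-to       : holds t → holds u
        ≋-from     : holds u → holds t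
    open _≋_

    ≋-isEquivalence : IsEquivalence _≋_
    ≋-isEquivalence = record
      { refl  = same refl refl id id
      ; sym   = λ s → same (sym (≋-variable s)) (sym (≋-value s)) (≋-from s) (≋-to s)
      ; trans = λ s s′ → same (trans (≋-variable s) (≋-variable s′)) (trans (≋-value s) (≋-value s′))
                              (≋-to s′ ∘ ≋-to s) (≋-from s ∘ ≋-from s′)
      }

    module ≋ = IsEquivalence ≋-isEquivalence

    ≡-coerce : {A B : Set} → A ≡ B → A → B
    ≡-coerce refl a = a

    op-≋ : ∀ o ts o′ ts′ → op-value o (values ts) ≡ op-value o′ (values ts′) →
           (op-holds o (values ts) → op-holds o′ (values ts′)) →
           (op-holds o′ (values ts′) → op-holds o (values ts)) → op o ts ≋ op o′ ts′
    op-≋ o ts o′ ts′ eq to from = same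
      (trans (variable-of-apply (symbol k o) (arity-symbol k o) ts)
             (sym (variable-of-apply (symbol k o′) (arity-symbol k o′) ts′)))
      (trans (value-op o ts) (trans eq (sym (value-op o′ ts′))))
      (≡-coerce (sym (holds-op o′ ts′)) ∘ to ∘ ≡-coerce (holds-op o ts))
      (≡-coerce (sym (holds-op o ts)) ∘ from ∘ ≡-coerce (holds-op o′ ts′))

    datum-≋ : ∀ {j} → j ≤ k → ∀ o ts → drop j quoted-word ≡ op-value o (values ts) →
              (op-holds o (values ts) → ⊥) → datum j ≋ op o ts
    datum-≋ {j} j≤k o ts eq not-holds = same
      (trans (variable-of-apply (datum-symbol ops j) (arity-datum-symbol {k} ops j) [])
             (sym (variable-of-apply (symbol k o) (arity-symbol k o) ts)))
      (trans (value-datum j≤k) (trans eq (sym (value-op o ts))))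
      (λ h → ⊥-elim (≡-coerce (holds-datum j≤k) h))
      (λ h → ⊥-elim (not-holds (≡-coerce (holds-op o ts) h)))

    distinguished-op : ∀ o ts → distinguished-term (op o ts) ≡ distinguished-symbol (inj₁ o)
    distinguished-op o ts =
      trans (distinguished-apply (symbol k o) (arity-symbol k o) ts)
            (cong distinguished-symbol (decode-symbol o))

    -- The second component keeps rules from applying at the root of `initial` or `accepted`.
    SoundRule : Rule (signature-of k) → Set
    SoundRule ρ = ∀ σ → subst σ (lhs ρ) ≋ subst σ (rhs ρ) ×
                        distinguished-term (subst σ (lhs ρ)) ≡ false

    distinguished-subst : ∀ σ f {n} (eq : n ≡ arity (signature-of k) f) ts →
      distinguished-term (subst σ (apply f eq ts)) ≡ distinguished-symbol (decode ops f)
    distinguished-subst σ f refl ts = refl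

    joint-≋ : ∀ σ e s → Sound (s , proj₁ (equation e)) →
              inst-side (triple σ) s ≋ op (joint e) (triple σ)
    joint-≋ σ e (h $ ts) sound
      with eq , to , from ← sound (value (σ 0)) (value (σ 1)) (value (σ 2)) =
      op-≋ (base h) (inst* (triple σ) ts) (joint e) (triple σ)
        (trans (cong (head-value h) (values-inst* σ ts)) eq)
        (to ∘ ≡-coerce (cong (head-holds h) (values-inst* σ ts)))
        (≡-coerce (cong (head-holds h) (sym (values-inst* σ ts))) ∘ from)

    joint-sound : ∀ e s → T (side-ok s) → Sound (s , proj₁ (equation e)) → SoundRule (joint-rule k e s)
    joint-sound e (h $ ts) ok sound σ =
      ≡-subst (_≋ _) (sym (subst-inst σ (h $ ts)))
        (≡-subst (_ ≋_) (sym (subst-op σ (joint e) vars)) (joint-≋ σ e (h $ ts) sound)) ,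
      trans (cong distinguished-term (subst-op σ (base h) (inst* vars ts)))
            (trans (distinguished-op (base h) _) (T-not (proj₁ (∧-split {not (distinguished (base h))} ok))))
      where
      T-not : ∀ {b} → T (not b) → b ≡ false
      T-not {false} _ = refl

    link-sound : ∀ o ts o′ ts′ → op-value o (values ts) ≡ op-value o′ (values ts′) →
                 (op-holds o (values ts) → op-holds o′ (values ts′)) →
                 (op-holds o′ (values ts′) → op-holds o (values ts)) →
                 distinguished-symbol (inj₁ o) ≡ false →
                 (∀ σ → subst* σ ts ≡ ts) → (∀ σ → subst* σ ts′ ≡ ts′) →
                 ∀ σ → subst σ (op o ts) ≋ subst σ (op o′ ts′) ×
                       distinguished-term (subst σ (op o ts)) ≡ false
    link-sound o ts o′ ts′ eq to from free closed closed′ σ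
      rewrite subst-op σ o ts | subst-op σ o′ ts′ | closed σ | closed′ σ =
      op-≋ o ts o′ ts′ eq to from , trans (distinguished-op o ts) free

    begin-sound : SoundRule (begin-rule k)
    begin-sound = link-sound (base (fn begin)) [] (base initial) [] refl id id refl (λ _ → refl) (λ _ → refl)

    finish-sound : SoundRule (finish-rule k)
    finish-sound = link-sound (base (fn finish)) [] (base accepted) [] refl id id refl (λ _ → refl) (λ _ → refl)

    datum-sound : ∀ {j} → j ≤ k → ∀ o ts → drop j quoted-word ≡ op-value o (values ts) →
                  (op-holds o (values ts) → ⊥) → (∀ σ → subst* σ ts ≡ ts) →
                  SoundRule (datum-rule-for k j (op o ts))
    datum-sound {j} j≤k o ts eq fails closed σ
      rewrite subst-datum σ j | subst-op σ o ts | closed σ =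
      datum-≋ j≤k o ts eq fails ,
      trans (distinguished-apply (datum-symbol ops j) (arity-datum-symbol {k} ops j) [])
            (cong distinguished-symbol (decode-datum-symbol ops j≤k))

    drop-suc : ∀ {A : Set} j (u : List A) {a u′} → drop j u ≡ a ∷ u′ → drop (suc j) u ≡ u′
    drop-suc zero    (a ∷ u) refl = refl
    drop-suc (suc j) (a ∷ u) eq   = drop-suc j u eq

    -- The invariant is that `u` is the suffix of the quoted word at `j`, which is what the constant
    -- cⱼ denotes.
    quotation-sound : ∀ u j → j + length u ≡ k → drop j quoted-word ≡ toWord u →
                      All SoundRule (quotation k u j)
    quotation-sound [] j eq d =
      datum-sound (ℕₚ.≤-trans (ℕₚ.m≤m+n j 0) (ℕₚ.≤-reflexive eq)) (base nil) [] d id (λ _ → refl) ∷ []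
    quotation-sound (a ∷ u) j eq d =
      datum-sound (ℕₚ.≤-trans (ℕₚ.n≤1+n j) j<k) (base (cell (letter a))) (datum (suc j) ∷ [])
        (trans d (cong (letter a ∷_) (trans (sym d′) (sym (value-datum j<k))))) id
        (λ σ → cong (_∷ []) (subst-datum σ (suc j))) ∷
      quotation-sound u (suc j) eq′ d′
      where
      eq′ : suc j + length u ≡ k
      eq′ = trans (sym (ℕₚ.+-suc j (length u))) eq
      j<k : suc j ≤ k
      j<k = ℕₚ.≤-trans (ℕₚ.m≤m+n (suc j) (length u)) (ℕₚ.≤-reflexive eq′)
      d′ : drop (suc j) quoted-word ≡ toWord u
      d′ = drop-suc j quoted-word d

    looping-sound : ∀ i → SoundRule (looping k i)
    looping-sound i σ =
      ≋.refl ,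
      trans (distinguished-subst σ (op-symbol ops (suc (suc i))) (arity-op-symbol {k} ops (suc (suc i)))
              (variables 0 _))
        (trans (cong distinguished-symbol (decode-op-symbol ops (suc (suc i))))
          (All.lookup other-ops-undistinguished (∈-lookup {xs = other-ops} i)))

    rules-sound : All SoundRule (rules R)
    rules-sound =
      Allₚ.++⁺
        (all-base-rules looping-sound
          (λ e → joint-sound e (proj₁ (equation e)) (proj₁ (equation-ok e)) (λ a b c → refl , id , id))
          (λ e → joint-sound e (proj₂ (equation e)) (proj₂ (equation-ok e)) (λ a b c →
            let eq , to , from = equation-sound e a b c in sym eq , from , to))
          begin-sound finish-sound)
        (quotation-sound w 0 refl refl)

    values-update : ∀ {n} (ts : Vec (Trm k) n) i {u} → value (lookup ts i) ≡ value u →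
                    values ts ≡ values (ts [ i ]≔ u)
    values-update (t ∷ ts) zero    eq = cong (_∷ values ts) eq
    values-update (t ∷ ts) (suc i) eq = cong (value t ∷_) (values-update ts i eq)

    step-≋ : ∀ {t u} → Step R t u → t ≋ u
    step-≋ (root ρ∈ σ) = proj₁ (All.lookup rules-sound ρ∈ σ)
    -- Both the word and the proposition at the root depend on the arguments only through their
    -- words, so equality of these suffices.
    step-≋ (inside {f} ts i s) = same refl (cong (symbol-value (decode ops f)) eq)
      (≡-coerce (cong (symbol-holds (decode ops f)) eq))
      (≡-coerce (cong (symbol-holds (decode ops f)) (sym eq)))
      where
      eq : values ts ≡ values (ts [ i ]≔ _)
      eq = values-update ts i (≋-value (step-≋ s))

    convertible-≋ : ∀ {t u} → Convertible R t u → t ≋ u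
    convertible-≋ = EqClosure.fold ≋-isEquivalence step-≋

    -- Normal forms

    Nullary : Trm k → Set
    Nullary (var _)    = ⊤
    Nullary (node f _) = arity (signature-of k) f ≡ 0

    -- No left-hand side has such a root, and a constant has no proper subterm to rewrite.
    distinguished-normal : ∀ t → distinguished-term t ≡ true → Nullary t → NormalForm R t
    distinguished-normal _ d _ _ (root ρ∈ σ) with () ← trans (sym d) (proj₂ (All.lookup rules-sound ρ∈ σ))
    distinguished-normal _ _ nullary _ (inside {f} ts i s) with () ← ≡-subst Fin nullary i

    initial-term accepted-term : Trm k
    initial-term  = node zero []
    accepted-term = node (suc zero) []

    Reducible : Trm k → Set
    Reducible t = ∃ λ u → Step R t u

    -- The variables are distinct, so the left-hand side of a loop matches every term with its root
    -- symbol.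
    matches-variables : ∀ (f : Symbol (signature-of k)) {n} (eq : n ≡ arity (signature-of k) f) ts →
      ∃ λ σ → subst σ (apply {F = signature-of k} f eq (variables 0 n)) ≡ node f ts
    matches-variables f refl ts =
      assign ts , cong (node f) (subst-variables (assign ts) 0 ts λ j → cong (assign ts) (ℕₚ.+-identityʳ j))

    matches-constant : ∀ (f : Symbol (signature-of k)) (eq : 0 ≡ arity (signature-of k) f) ts →
                       apply {F = signature-of k} f eq [] ≡ node f ts
    matches-constant f eq ts with matches-variables f eq ts
    ... | σ , eq′ = trans (sym (subst-apply {F = signature-of k} σ f eq [])) eq′

    looping-reducible : ∀ i ts → Reducible (node {signature-of k} (op-symbol ops (suc (suc i))) ts)
    looping-reducible i ts with matches-variables f (arity-op-symbol {k} ops (suc (suc i))) ts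
      where f = op-symbol ops (suc (suc i))
    ... | σ , eq = ≡-subst Reducible eq
      (_ , root {ρ = looping k i} (∈-++⁺ˡ (there (there (∈-++⁺ˡ (∈-map⁺ (looping k) (∈-allFin i)))))) σ)

    ∈-quotation : ∀ u i {j} → j ≤ length u → ∃ λ t → datum-rule-for k (j + i) t ∈ quotation k u i
    ∈-quotation []      i z≤n = _ , here refl
    ∈-quotation (a ∷ u) i z≤n = _ , here refl
    ∈-quotation (a ∷ u) i {suc j} (s≤s j≤) with ∈-quotation u (suc i) j≤
    ... | t , ∈u = t , there (≡-subst (λ n → datum-rule-for k n t ∈ quotation k u (suc i)) (ℕₚ.+-suc j i) ∈u)

    datum-reducible : ∀ {j} → j ≤ k → ∀ ts → Reducible (node {signature-of k} (datum-symbol ops j) ts)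
    datum-reducible {j} j≤k ts with ∈-quotation w 0 j≤k
    ... | t , ∈q = ≡-subst Reducible
      (trans (cong (subst var) (cong datum (ℕₚ.+-identityʳ j)))
        (trans (subst-datum var j) (matches-constant (datum-symbol ops j) (arity-datum-symbol {k} ops j) ts)))
      (_ , root (∈-++⁺ʳ (base-rules k) ∈q) var)

    constant-view : ∀ m f → ∃ λ j → j ≤ m × f ≡ constant m j
    constant-view m       zero    = 0 , z≤n , refl
    constant-view (suc m) (suc f) with constant-view m f
    ... | j , j≤m , refl = suc j , s≤s j≤m , refl

    symbol-view : ∀ os (f : Fin (length (map op-arity os ++ replicate (suc k) 0))) →
      (∃ λ i → f ≡ op-symbol os i) ⊎ (∃ λ j → j ≤ k × f ≡ datum-symbol os j)
    symbol-view []       f    = inj₂ (constant-view k f)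
    symbol-view (o ∷ os) zero = inj₁ (zero , refl)
    symbol-view (o ∷ os) (suc f) with symbol-view os f
    ... | inj₁ (i , refl)       = inj₁ (suc i , refl)
    ... | inj₂ (j , j≤k , refl) = inj₂ (j , j≤k , refl)

    -- Every other symbol either has a loop or is a constant of the chain, which has a rule of its
    -- own.
    normal-node : ∀ f ts → NormalForm R (node f ts) → node f ts ≡ initial-term ⊎ node f ts ≡ accepted-term
    normal-node f ts nf with symbol-view ops f
    normal-node f [] nf | inj₁ (zero , refl)     = inj₁ refl
    normal-node f [] nf | inj₁ (suc zero , refl) = inj₂ refl
    normal-node f ts nf | inj₁ (suc (suc i) , refl) with u , s ← looping-reducible i ts = ⊥-elim (nf u s)
    normal-node f ts nf | inj₂ (j , j≤k , refl) with u , s ← datum-reducible j≤k ts = ⊥-elim (nf u s)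

    Accepts : Set
    Accepts = Accepting start (tape-at right [] own-text)

    -- The invariant separates variables from everything else, which leaves the pair `initial` and
    -- `accepted`. The latter denotes truth, so a conversion would make the former, acceptance by
    -- `M`, true as well.
    UN⁼-unless-accepting : ¬ Accepts → UN⁼ R
    UN⁼-unless-accepting rejects (t , u , nf , nf′ , t≢u , t↔u) = distinct t u nf nf′ t≢u (convertible-≋ t↔u)
      where
      distinct : ∀ t u → NormalForm R t → NormalForm R u → t ≢ u → t ≋ u → ⊥
      distinct (var i) (var .i) _ _ t≢u (same refl _ _ _) = t≢u refl
      distinct (var i) (node f ts) _ _ _ (same () _ _ _)
      distinct (node f ts) (var i) _ _ _ (same () _ _ _)
      distinct (node f ts) (node g us) nf nf′ t≢u s with normal-node f ts nf | normal-node g us nf′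
      ... | inj₁ eq | inj₁ eq′ = t≢u (trans eq (sym eq′))
      ... | inj₂ eq | inj₂ eq′ = t≢u (trans eq (sym eq′))
      ... | inj₁ refl | inj₂ refl = rejects (≋-from s tt)
      ... | inj₂ refl | inj₁ refl = rejects (≋-to s tt)

    -- Conversions

    infix 4 _≈_
    infixr 5 _⨾_
    infixr 6 _·_

    _≈_ : Trm k → Trm k → Set
    _≈_ = Convertible R

    _⨾_ : ∀ {t u v} → t ≈ u → u ≈ v → t ≈ v
    _⨾_ = EqClosure.transitive (Step R)

    ≈-refl : ∀ {t} → t ≈ t
    ≈-refl = EqClosure.reflexive (Step R)

    ≈-sym : ∀ {t u} → t ≈ u → u ≈ t
    ≈-sym = EqClosure.symmetric (Step R)

    -- The arguments are converted from left to right; those already treated become part of the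
    -- context `C`.
    context-≈ : ∀ {n} (C : Vec (Trm k) n → Trm k) →
                (∀ ts i {u} → Step R (lookup ts i) u → Step R (C ts) (C (ts [ i ]≔ u))) →
                ∀ {ts us} → Pointwise _≈_ ts us → C ts ≈ C us
    context-≈ C inside-C [] = ≈-refl
    context-≈ C inside-C {t ∷ ts} {u ∷ us} (t≈u ∷ ts≈us) =
      EqClosure.gmap (λ s → C (s ∷ ts)) (inside-C (_ ∷ ts) zero) t≈u ⨾
      context-≈ (λ ss → C (u ∷ ss)) (λ ss i → inside-C (u ∷ ss) (suc i)) ts≈us

    apply-inside : ∀ (f : Symbol (signature-of k)) {n} (eq : n ≡ arity (signature-of k) f) ts i {u} →
      Step R (lookup ts i) u → Step R (apply f eq ts) (apply f eq (ts [ i ]≔ u))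
    apply-inside f refl ts i = inside ts i

    op-≈ : ∀ o {ts us} → Pointwise _≈_ ts us → op o ts ≈ op o us
    op-≈ o = context-≈ (op o) (apply-inside (symbol k o) (arity-symbol k o))

    joint-rule-≈ : ∀ e s → joint-rule k e s ∈ rules R → ∀ a b c →
                   inst-side (a ∷ b ∷ c ∷ []) s ≈ op (joint e) (a ∷ b ∷ c ∷ [])
    joint-rule-≈ e (h $ ts) ρ∈ a b c =
      EqClosure.return (≡-subst₂ (Step R) (subst-inst σ (h $ ts)) (subst-op σ (joint e) vars) (root ρ∈ σ))
      where σ = assign (a ∷ b ∷ c ∷ [])

    -- Both sides meet in the joint, by one rule forwards and the other backwards.
    equation-≈ : ∀ e a b c → inst-side (a ∷ b ∷ c ∷ []) (proj₁ (equation e)) ≈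
                             inst-side (a ∷ b ∷ c ∷ []) (proj₂ (equation e))
    equation-≈ e a b c =
      joint-rule-≈ e (proj₁ (equation e)) (∈R (∈-++⁺ˡ left∈)) a b c ⨾
      ≈-sym (joint-rule-≈ e (proj₂ (equation e)) (∈R (∈-++⁺ʳ (map (left-rule k) equations) right∈)) a b c)
      where
      ∈R : ∀ {ρ} → ρ ∈ map (left-rule k) equations ++ map (right-rule k) equations → ρ ∈ rules R
      ∈R ρ∈ = ∈-++⁺ˡ (there (there (∈-++⁺ʳ (map (looping k) (allFin (length other-ops))) ρ∈)))
      left∈ = ∈-map⁺ (left-rule k) (∈-equations e)
      right∈ = ∈-map⁺ (right-rule k) (∈-equations e)

    law-≈ : ∀ l a b c → inst-side (a ∷ b ∷ c ∷ []) (proj₁ (law l)) ≈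
                        inst-side (a ∷ b ∷ c ∷ []) (proj₂ (law l))
    law-≈ l = equation-≈ (static l)

    -- Words as terms, and the conversions that print the encoding.

    _·_ : Cell → Trm k → Trm k
    s · t = op (base (cell s)) (t ∷ [])

    ε : Trm k
    ε = op (base nil) []

    word : Word → Trm k
    word []      = ε
    word (s ∷ u) = s · word u

    numeral : ℕ → Trm k
    numeral n = word (𝟏 ^ n ◃ [])

    call : ∀ f → Vec (Trm k) (head-arity (fn f)) → Trm k
    call f = op (base (fn f))

    ·-≈ : ∀ s {t u} → t ≈ u → s · t ≈ s · u
    ·-≈ s t≈u = op-≈ (base (cell s)) (t≈u ∷ [])


    -- Strokes printed from the second argument pile up in the third, so the continuation always
    -- starts at the invariant sum `n + m`.
    lhs-≈ : ∀ t n m {u} → call datum-word (t ∷ numeral (n + m) ∷ []) ≈ word u →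
            call datum-lhs (t ∷ numeral n ∷ numeral m ∷ []) ≈ word (𝟏 ^ n ◃ (letter 𝐞 ∷ letter 𝐟 ∷ u))
    lhs-≈ t zero m h =
      law-≈ datum-lhs-end t ε (numeral m) ⨾
      ·-≈ (letter 𝐞) (law-≈ datum-rhs-law t (numeral m) ε ⨾ ·-≈ (letter 𝐟) h)
    lhs-≈ t (suc n) m {u} h =
      law-≈ datum-lhs-𝟏 t (numeral n) (numeral m) ⨾
      ·-≈ (letter 𝟏) (law-≈ datum-lhs⁺-law t (numeral n) (numeral m) ⨾
        lhs-≈ t n (suc m) (≡-subst (λ i → call datum-word (t ∷ numeral i ∷ []) ≈ word u)
                                   (sym (ℕₚ.+-suc n m)) h))

    rhs-index-≈ : ∀ t n m {u} → call datum-rules (t ∷ numeral (n + m) ∷ []) ≈ word u →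
                  call datum-rhs-index (t ∷ numeral n ∷ numeral m ∷ []) ≈ word (𝟏 ^ n ◃ (letter 𝐞 ∷ u))
    rhs-index-≈ t zero m h = law-≈ datum-rhs-index-end t ε (numeral m) ⨾ ·-≈ (letter 𝐞) h
    rhs-index-≈ t (suc n) m {u} h =
      law-≈ datum-rhs-index-𝟏 t (numeral n) (numeral m) ⨾
      ·-≈ (letter 𝟏) (law-≈ datum-rhs-index⁺-law t (numeral n) (numeral m) ⨾
        rhs-index-≈ t n (suc m) (≡-subst (λ i → call datum-rules (t ∷ numeral i ∷ []) ≈ word u)
                                         (sym (ℕₚ.+-suc n m)) h))

    -- The number `i` is kept beside `j` for the recursion, since `inject₁ j` in `ones-suc` is not a
    -- subterm of `suc j`.
    ones-≈ : ∀ i {j} → toℕ j ≡ i → ∀ t n {u} → call datum-rules (t ∷ numeral (suc n) ∷ []) ≈ word u →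
             op (base (ones j)) (t ∷ numeral n ∷ []) ≈
             word (𝟏 ^ i ◃ (letter 𝐞 ∷ letter 𝐟 ∷ (𝟏 ^ suc n ◃ (letter 𝐞 ∷ u))))
    ones-≈ zero {zero} _ t n {u} h =
      law-≈ ones-zero t (numeral n) ε ⨾
      ·-≈ (letter 𝐞) (law-≈ datum-arg-law t (numeral n) ε ⨾
        ·-≈ (letter 𝐟) (law-≈ datum-index-law t (numeral n) ε ⨾
          rhs-index-≈ t (suc n) 0 (≡-subst (λ i → call datum-rules (t ∷ numeral i ∷ []) ≈ word u)
                                           (sym (ℕₚ.+-identityʳ (suc n))) h)))
    ones-≈ (suc i) {suc j} eq t n h =
      equation-≈ (ones-suc j) t (numeral n) ε ⨾
      ·-≈ (letter 𝟏) (ones-≈ i (trans (toℕ-inject₁ j) (ℕₚ.suc-injective eq)) t n h)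

    mutual
      datum-rules-≈ : ∀ u n → call datum-rules (word (toWord u) ∷ numeral n ∷ []) ≈
                              word (quotation-text (toWord u) n)
      datum-rules-≈ u n =
        law-≈ datum-rules-law t (numeral n) ε ⨾
        ·-≈ (letter 𝐫) (law-≈ datum-rule-law t (numeral n) ε ⨾
          ·-≈ (letter 𝐟) (lhs-≈ t n 0 (≡-subst (λ i → call datum-word (t ∷ numeral i ∷ []) ≈ word (rhs-text (toWord u) n))
            (sym (ℕₚ.+-identityʳ n)) (datum-word-≈ u n))))
        where t = word (toWord u)

      datum-word-≈ : ∀ u n → call datum-word (word (toWord u) ∷ numeral n ∷ []) ≈ word (rhs-text (toWord u) n)
      datum-word-≈ [] n =
        law-≈ datum-word-end ε (numeral n) ε ⨾ ·-≈ (letter 𝟏) (law-≈ last-rule-law ε ε ε)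
      datum-word-≈ (a ∷ u) n =
        equation-≈ (datum-word-cell a) (word (toWord u)) (numeral n) ε ⨾
        ones-≈ (toℕ (code a)) refl (word (toWord u)) n (datum-rules-≈ u (suc n))

    quotation-≈ : ∀ u j → (∀ {ρ} → ρ ∈ quotation k u j → ρ ∈ rules R) → datum j ≈ word (toWord u)
    quotation-≈ [] j ∈R =
      EqClosure.return (≡-subst₂ (Step R) (subst-datum var j) (subst-op var (base nil) [])
        (root (∈R (here refl)) var))
    quotation-≈ (a ∷ u) j ∈R =
      EqClosure.return (≡-subst₂ (Step R) (subst-datum var j)
        (trans (subst-op var (base (cell (letter a))) (datum (suc j) ∷ []))
               (cong (letter a ·_) (subst-datum var (suc j))))
        (root (∈R (here refl)) var)) ⨾
      ·-≈ (letter a) (quotation-≈ u (suc j) (∈R ∘ there))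

    quoted-≈ : datum 0 ≈ word quoted-word
    quoted-≈ = quotation-≈ w 0 (∈-++⁺ʳ (base-rules k))

    copy-rules-≈ : ∀ u n → call copy-rules (word (toWord u) ∷ numeral n ∷ []) ≈
                           word (toWord u ++ quotation-text quoted-word n)
    copy-rules-≈ [] n =
      law-≈ copy-rules-end ε (numeral n) ε ⨾
      op-≈ (base (fn datum-rules)) (quoted-≈ ∷ ≈-refl ∷ []) ⨾ datum-rules-≈ w n
    copy-rules-≈ (a ∷ u) n =
      equation-≈ (copy-rules-cell a) (word (toWord u)) (numeral n) ε ⨾ ·-≈ (letter a) (copy-rules-≈ u n)

    pad-≈ : ∀ u u′ n → call pad (word (toWord u) ∷ word (toWord u′) ∷ numeral n ∷ []) ≈
                       word (padded (toWord u) (length (toWord u′)) n)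
    pad-≈ u [] n =
      law-≈ pad-end (word (toWord u)) ε (numeral n) ⨾ ·-≈ (letter 𝐫) (copy-rules-≈ u n)
    pad-≈ u (a ∷ u′) n =
      equation-≈ (pad-cell a) (word (toWord u)) (word (toWord u′)) (numeral n) ⨾
      ·-≈ (letter 𝐞) (pad-≈ u u′ n)

    -- Established for words of arities followed by `𝐫`: `copies-𝐫` is the starting point, and the
    -- other lemmas prolong the word to the left.
    Copies : List Letter → ℕ → Set
    Copies u n = call copy-sig (word (toWord u) ∷ numeral n ∷ []) ≈ word (copied (toWord u) n)

    copies-𝟏 : ∀ u n → Copies u n → Copies (𝟏 ∷ u) n
    copies-𝟏 u n h = law-≈ copy-sig-𝟏 (word (toWord u)) (numeral n) ε ⨾ ·-≈ (letter 𝟏) h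

    copies-𝐞 : ∀ u n → Copies u (suc n) → Copies (𝐞 ∷ u) n
    copies-𝐞 u n h =
      law-≈ copy-sig-𝐞 (word (toWord u)) (numeral n) ε ⨾
      ·-≈ (letter 𝐞) (law-≈ copy-sig⁺-law (word (toWord u)) (numeral n) ε ⨾ h)

    copies-𝐫 : ∀ u n → Copies (𝐫 ∷ u) (suc n)
    copies-𝐫 u n =
      law-≈ copy-sig-𝐫 (word (toWord u)) (numeral n) ε ⨾
      op-≈ (base (fn pad)) (≈-refl ∷ quoted-≈ ∷ ≈-refl ∷ []) ⨾ pad-≈ u w n

    copies-numeral : ∀ m u n → Copies u (suc n) → Copies (encode-ℕ m ++ u) n
    copies-numeral zero    u n h = copies-𝐞 u n h
    copies-numeral (suc m) u n h = copies-𝟏 (encode-ℕ m ++ u) n (copies-numeral m u n h)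

    copies-signature : ∀ ms u n → Copies u (length ms + n) → Copies (concatMap encode-ℕ ms ++ u) n
    copies-signature []       u n h = h
    copies-signature (m ∷ ms) u n h =
      ≡-subst (λ u′ → Copies u′ n) (sym (Listₚ.++-assoc (encode-ℕ m) (concatMap encode-ℕ ms) u))
        (copies-numeral m (concatMap encode-ℕ ms ++ u) n
          (copies-signature ms u (suc n) (≡-subst (Copies u) (sym (ℕₚ.+-suc (length ms) n)) h)))

    -- Simulation of accepting runs.

    configuration : State → Tape #aux → Trm k
    configuration q (tape l s r) = op (base (run q s)) (word l ∷ word r ∷ [])

    load-≈ : ∀ d q l r → op (base (load d q)) (word l ∷ word r ∷ []) ≈ configuration q (tape-at d l r)
    load-≈ left  q []      r       = equation-≈ (read-blank left q) ε (word r) ε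
    load-≈ left  q (s ∷ l) r       = equation-≈ (read left q s) (word l) (word r) ε
    load-≈ right q l       []      = equation-≈ (read-blank right q) (word l) ε ε
    load-≈ right q l       (s ∷ r) = equation-≈ (read right q s) (word l) (word r) ε

    reaction-≈ : ∀ q l s r {α} → δ q s ≡ α →
                 configuration q (tape l s r) ≈ inst-side (word l ∷ word r ∷ ε ∷ []) (reaction q s α)
    reaction-≈ q l s r refl = equation-≈ (act q s) (word l) (word r) ε

    -- Induction on the run: each transition is an `act` equation followed by the loading of the
    -- next cell.
    accepting-≈ : ∀ {q t} → Accepting q t → configuration q t ≈ call finish []
    accepting-≈ {q} {tape l s r} (stop eq) = reaction-≈ q l s r eq
    accepting-≈ {q} {tape l s r} (step {q′ = q′} {s = b} {d = left} eq h) =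
      reaction-≈ q l s r eq ⨾ load-≈ left q′ l (b ∷ r) ⨾
      ≡-subst (λ t → configuration q′ t ≈ call finish []) (write-move-left b l s r) (accepting-≈ h)
    accepting-≈ {q} {tape l s r} (step {q′ = q′} {s = b} {d = right} eq h) =
      reaction-≈ q l s r eq ⨾ load-≈ right q′ (b ∷ l) r ⨾
      ≡-subst (λ t → configuration q′ t ≈ call finish []) (write-move-right b l s r) (accepting-≈ h)

    link-≈ : ∀ {ρ t u} → ρ ∈ rules R → (∀ σ → subst σ (lhs ρ) ≡ t) → (∀ σ → subst σ (rhs ρ) ≡ u) → t ≈ u
    link-≈ ρ∈ l r = EqClosure.return (≡-subst₂ (Step R) (l var) (r var) (root ρ∈ var))

    ends-≈ : call begin [] ≈ initial-term × call finish [] ≈ accepted-term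
    ends-≈ =
      link-≈ {begin-rule k} (here refl) (λ σ → subst-op σ (base (fn begin)) []) (λ σ → refl) ,
      link-≈ {finish-rule k} (there (here refl)) (λ σ → subst-op σ (base (fn finish)) []) (λ σ → refl)

    -- The hypothesis `Copies w 0` restricts the form of `w`; `copies-base-text` supplies it for the
    -- word that is finally quoted.
    ¬UN⁼-if-accepting : Copies w 0 → Accepts → ¬ UN⁼ R
    ¬UN⁼-if-accepting copies h un =
      un (initial-term , accepted-term ,
          distinguished-normal initial-term refl refl , distinguished-normal accepted-term refl refl ,
          (λ ()) , conversion)
      where
      own-text-≈ : call self [] ≈ word own-text
      own-text-≈ = law-≈ self-law ε ε ε ⨾ op-≈ (base (fn copy-sig)) (quoted-≈ ∷ ≈-refl ∷ []) ⨾ copies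
      conversion : initial-term ≈ accepted-term
      conversion =
        -- From `initial` back to `begin`, on to the start with the symbolic word `self`, which is
        -- then evaluated so that the run can be simulated up to `finish` and `accepted`.
        ≈-sym (proj₁ ends-≈) ⨾ law-≈ begin-law ε ε ε ⨾
        op-≈ (base (load right start)) (≈-refl ∷ own-text-≈ ∷ []) ⨾
        load-≈ right start [] own-text ⨾ accepting-≈ h ⨾ proj₂ ends-≈

  -- The fixed point

  encode-op : ∀ {k} o (ts : Vec (Trm k) (op-arity o)) →
              encode-Term (op o ts) ≡ 𝐟 ∷ encode-ℕ (toℕ (op-index o)) ++ encode-Terms ts
  encode-op {k} o ts =
    trans (encode-apply {F = signature-of k} (symbol k o) (arity-symbol k o) ts)
          (cong (λ i → 𝐟 ∷ encode-ℕ i ++ encode-Terms ts) (toℕ-op-symbol {k} ops (op-index o)))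

  encode-datum : ∀ {k j} → j ≤ k → encode-Term (datum {k} j) ≡ 𝐟 ∷ encode-ℕ (length ops + j)
  encode-datum {k} {j} j≤k =
    trans (encode-apply {F = signature-of k} (datum-symbol ops j) (arity-datum-symbol {k} ops j) [])
      (trans (cong (𝐟 ∷_) (Listₚ.++-identityʳ _))
             (cong (λ i → 𝐟 ∷ encode-ℕ i) (toℕ-datum-symbol ops j≤k)))

  module _ (k : ℕ) where

    encode-variables : ∀ i n → encode-Terms {signature-of k} (variables i n) ≡
                               encode-Terms {signature-of 0} (variables i n)
    encode-variables i zero    = refl
    encode-variables i (suc n) = cong (encode-Term {signature-of 0} (var i) ++_) (encode-variables (suc i) n)

    encode-looping : ∀ i → encode-Rule (looping k i) ≡ encode-Rule (looping 0 i)
    encode-looping i = cong (λ t → 𝐫 ∷ t ++ t) (trans (encoding k) (trans eq (sym (encoding 0))))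
      where
      j = suc (suc i)
      n = op-arity (List.lookup ops j)
      encoding : ∀ l → encode-Term (lhs (looping l i)) ≡
                       𝐟 ∷ encode-ℕ (toℕ j) ++ encode-Terms {signature-of l} (variables 0 n)
      encoding l =
        trans (encode-apply {F = signature-of l} (op-symbol ops j) (arity-op-symbol {l} ops j) (variables 0 n))
              (cong (λ m → 𝐟 ∷ encode-ℕ m ++ encode-Terms {signature-of l} (variables 0 n))
                    (toℕ-op-symbol {l} ops j))
      eq : 𝐟 ∷ encode-ℕ (toℕ j) ++ encode-Terms {signature-of k} (variables 0 n) ≡
           𝐟 ∷ encode-ℕ (toℕ j) ++ encode-Terms {signature-of 0} (variables 0 n)
      eq = cong (λ u → 𝐟 ∷ encode-ℕ (toℕ j) ++ u) (encode-variables 0 n)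

    encode-op-cong : ∀ o (ts : Vec (Trm k) (op-arity o)) (us : Vec (Trm 0) (op-arity o)) →
                     encode-Terms ts ≡ encode-Terms us → encode-Term (op o ts) ≡ encode-Term (op o us)
    encode-op-cong o ts us eq =
      trans (encode-op o ts)
        (trans (cong (λ u → 𝐟 ∷ encode-ℕ (toℕ (op-index o)) ++ u) eq) (sym (encode-op o us)))

    mutual
      encode-inst : ∀ t → encode-Term (inst (vars {k}) t) ≡ encode-Term (inst (vars {0}) t)
      encode-inst (v zero)             = refl
      encode-inst (v (suc zero))       = refl
      encode-inst (v (suc (suc zero))) = refl
      encode-inst quoted   = trans (encode-datum {k} z≤n) (sym (encode-datum {0} z≤n))
      encode-inst (h $ ts) = encode-op-cong (base h) _ _ (encode-inst* ts)

      encode-inst* : ∀ {n} (ts : Vec Pattern n) →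
                     encode-Terms (inst* (vars {k}) ts) ≡ encode-Terms (inst* (vars {0}) ts)
      encode-inst* []       = refl
      encode-inst* (t ∷ ts) = cong₂ _++_ (encode-inst t) (encode-inst* ts)

    encode-joint-rule : ∀ e s → encode-Rule (joint-rule k e s) ≡ encode-Rule (joint-rule 0 e s)
    encode-joint-rule e (h $ ts) =
      cong₂ (λ t u → 𝐫 ∷ t ++ u) (encode-op-cong (base h) _ _ (encode-inst* ts))
            (encode-op-cong (joint e) vars vars (encode-variables 0 3))

    encode-begin-rule : encode-Rule (begin-rule k) ≡ encode-Rule (begin-rule 0)
    encode-begin-rule =
      cong₂ (λ t u → 𝐫 ∷ t ++ u) (encode-op-cong (base (fn begin)) [] [] refl)
                                 (encode-op-cong (base initial) [] [] refl)

    encode-finish-rule : encode-Rule (finish-rule k) ≡ encode-Rule (finish-rule 0)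
    encode-finish-rule =
      cong₂ (λ t u → 𝐫 ∷ t ++ u) (encode-op-cong (base (fn finish)) [] [] refl)
                                 (encode-op-cong (base accepted) [] [] refl)

    SameText : Rule (signature-of k) → Rule (signature-of 0) → Set
    SameText ρ τ = encode-Rule ρ ≡ encode-Rule τ

    same-text-map : {A : Set} (f : A → Rule (signature-of k)) (g : A → Rule (signature-of 0)) →
                    (∀ a → SameText (f a) (g a)) → ∀ as → Pw.Pointwise SameText (map f as) (map g as)
    same-text-map f g eq as = Pw.map⁺ f g (Pw.refl (eq _))

    encode-rules : ∀ {ρs τs} → Pw.Pointwise SameText ρs τs →
                   concatMap encode-Rule ρs ≡ concatMap encode-Rule τs
    encode-rules Pw.[]         = refl
    encode-rules (eq Pw.∷ eqs) = cong₂ _++_ eq (encode-rules eqs)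

    -- Symbols are written by position, and the base rules use no position beyond that of c₀. This
    -- breaks the circle between the quoted text and the number `k` of its letters.
    encode-base-rules : concatMap encode-Rule (base-rules k) ≡ concatMap encode-Rule (base-rules 0)
    encode-base-rules = encode-rules {base-rules k} {base-rules 0}
      (encode-begin-rule Pw.∷ encode-finish-rule Pw.∷ Pw.++⁺
        (same-text-map (looping k) (looping 0) encode-looping (allFin (length other-ops)))
        (Pw.++⁺
          (same-text-map (left-rule k) (left-rule 0)
            (λ e → encode-joint-rule e (proj₁ (equation e))) equations)
          (same-text-map (right-rule k) (right-rule 0)
            (λ e → encode-joint-rule e (proj₂ (equation e))) equations)))

  base-arities : List ℕ
  base-arities = map op-arity ops ++ 0 ∷ []

  base-rules-text : List Letter
  base-rules-text = concatMap encode-Rule (base-rules 0)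

  -- The encoding of the system for the empty word, short of the one rule of its chain.
  base-text : List Letter
  base-text = concatMap encode-ℕ base-arities ++ base-rules-text

  open Model base-text

  -- The count that `copy-sig` reaches at the first `𝐫`; it includes c₀ and so exceeds the position
  -- of c₀ by one.
  length-base-arities : length base-arities + 0 ≡ suc (length ops)
  length-base-arities =
    trans (ℕₚ.+-identityʳ _) (trans (Listₚ.length-++ (map op-arity ops))
      (trans (ℕₚ.+-comm _ 1) (cong suc (Listₚ.length-map op-arity ops))))

  copies-base-text : Copies base-text 0
  copies-base-text =
    copies-signature base-arities base-rules-text 0
      -- The text of the base rules begins with the `𝐫` of `begin-rule`, so it has the shape that
      -- `copies-𝐫` requires.
      (≡-subst (Copies base-rules-text) (sym length-base-arities) (copies-𝐫 _ (length ops)))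

  toWord-++ : ∀ u u′ → toWord (u ++ u′) ≡ toWord u ++ toWord u′
  toWord-++ = Listₚ.map-++ letter

  copied-numeral : ∀ m u n → copied (toWord (encode-ℕ m ++ u)) n ≡
                             toWord (encode-ℕ m) ++ copied (toWord u) (suc n)
  copied-numeral zero    u n = refl
  copied-numeral (suc m) u n = cong (letter 𝟏 ∷_) (copied-numeral m u n)

  copied-signature : ∀ ms u n → copied (toWord (concatMap encode-ℕ ms ++ u)) n ≡
                                toWord (concatMap encode-ℕ ms) ++ copied (toWord u) (length ms + n)
  copied-signature []       u n = refl
  copied-signature (m ∷ ms) u n = begin-≡
    copied (toWord ((encode-ℕ m ++ ns) ++ u)) n
      ≡⟨ cong (λ u′ → copied (toWord u′) n) (Listₚ.++-assoc (encode-ℕ m) ns u) ⟩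
    copied (toWord (encode-ℕ m ++ ns ++ u)) n
      ≡⟨ copied-numeral m (ns ++ u) n ⟩
    toWord (encode-ℕ m) ++ copied (toWord (ns ++ u)) (suc n)
      ≡⟨ cong (toWord (encode-ℕ m) ++_) (copied-signature ms u (suc n)) ⟩
    toWord (encode-ℕ m) ++ toWord ns ++ copied (toWord u) (length ms + suc n)
      ≡⟨ cong (λ i → toWord (encode-ℕ m) ++ toWord ns ++ copied (toWord u) i) (ℕₚ.+-suc (length ms) n) ⟩
    toWord (encode-ℕ m) ++ toWord ns ++ copied (toWord u) (suc (length ms + n))
      ≡⟨ sym (Listₚ.++-assoc (toWord (encode-ℕ m)) (toWord ns) _) ⟩
    (toWord (encode-ℕ m) ++ toWord ns) ++ copied (toWord u) (suc (length ms + n))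
      ≡⟨ cong (_++ _) (sym (toWord-++ (encode-ℕ m) ns)) ⟩
    toWord (encode-ℕ m ++ ns) ++ copied (toWord u) (suc (length ms + n)) ∎
    where ns = concatMap encode-ℕ ms

  toWord-numeral : ∀ n u → toWord (encode-ℕ n ++ u) ≡ 𝟏 ^ n ◃ (letter 𝐞 ∷ toWord u)
  toWord-numeral zero    u = refl
  toWord-numeral (suc n) u = cong (letter 𝟏 ∷_) (toWord-numeral n u)

  -- This identifies the printed text with the encoding of the chain: cⱼ is at position
  -- `length ops + j`, `nil` at 2 and a letter at its `code`.
  quotation-encoding : ∀ u j → j + length u ≤ k →
    toWord (concatMap encode-Rule (quotation k u j)) ≡ quotation-text (toWord u) (length ops + j)
  quotation-encoding [] j j≤ = begin-≡
    toWord ((𝐫 ∷ encode-Term (datum {k} j) ++ encode-Term (op {k} (base nil) [])) ++ [])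
      ≡⟨ cong toWord (Listₚ.++-identityʳ _) ⟩
    toWord (𝐫 ∷ encode-Term (datum {k} j) ++ encode-Term (op {k} (base nil) []))
      ≡⟨ cong₂ (λ t u → toWord (𝐫 ∷ t ++ u)) (encode-datum {k} (≤-via (sym (ℕₚ.+-identityʳ j)) j≤)) nil-text ⟩
    toWord (𝐫 ∷ 𝐟 ∷ encode-ℕ (length ops + j) ++ 𝐟 ∷ encode-ℕ 2)
      ≡⟨ cong (λ u → letter 𝐫 ∷ letter 𝐟 ∷ u) (toWord-numeral (length ops + j) _) ⟩
    quotation-text [] (length ops + j) ∎
    where
    nil-text : encode-Term (op {k} (base nil) []) ≡ 𝐟 ∷ encode-ℕ 2
    nil-text = trans (encode-op {k} (base nil) [])
      (trans (cong (𝐟 ∷_) (Listₚ.++-identityʳ _)) (cong (λ i → 𝐟 ∷ encode-ℕ (2 + i)) other-index-nil))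
  quotation-encoding (a ∷ u) j j≤ = begin-≡
    toWord ((𝐫 ∷ encode-Term (datum {k} j) ++ encode-Term (op {k} (base (cell (letter a))) (datum (suc j) ∷ []))) ++ rest)
      ≡⟨ cong₂ (λ t u → toWord ((𝐫 ∷ t ++ u) ++ rest)) (encode-datum {k} (ℕₚ.≤-trans (ℕₚ.n≤1+n j) j<k)) cell-text ⟩
    toWord ((𝐫 ∷ 𝐟 ∷ encode-ℕ (L + j) ++ 𝐟 ∷ encode-ℕ (toℕ (code a)) ++ 𝐟 ∷ encode-ℕ (L + suc j)) ++ rest)
      ≡⟨ cong (λ u → toWord (𝐫 ∷ 𝐟 ∷ u)) (Listₚ.++-assoc (encode-ℕ (L + j)) _ rest) ⟩
    toWord (𝐫 ∷ 𝐟 ∷ encode-ℕ (L + j) ++ 𝐟 ∷ (encode-ℕ (toℕ (code a)) ++ 𝐟 ∷ encode-ℕ (L + suc j)) ++ rest)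
      ≡⟨ cong (λ u → toWord (𝐫 ∷ 𝐟 ∷ encode-ℕ (L + j) ++ 𝐟 ∷ u)) (Listₚ.++-assoc (encode-ℕ (toℕ (code a))) _ rest) ⟩
    toWord (𝐫 ∷ 𝐟 ∷ encode-ℕ (L + j) ++ 𝐟 ∷ encode-ℕ (toℕ (code a)) ++ 𝐟 ∷ encode-ℕ (L + suc j) ++ rest)
      ≡⟨ cong (λ u → letter 𝐫 ∷ letter 𝐟 ∷ u) (toWord-numeral (L + j) _) ⟩
    letter 𝐫 ∷ letter 𝐟 ∷ (𝟏 ^ (L + j) ◃ (letter 𝐞 ∷ letter 𝐟 ∷ toWord (encode-ℕ (toℕ (code a)) ++ 𝐟 ∷ encode-ℕ (L + suc j) ++ rest)))
      ≡⟨ cong (λ u → letter 𝐫 ∷ letter 𝐟 ∷ (𝟏 ^ (L + j) ◃ (letter 𝐞 ∷ letter 𝐟 ∷ u))) tail-text ⟩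
    quotation-text (toWord (a ∷ u)) (L + j) ∎
    where
    L = length ops
    rest = concatMap encode-Rule (quotation k u (suc j))
    j+u≤k : suc j + length u ≤ k
    j+u≤k = ≤-via (sym (ℕₚ.+-suc j (length u))) j≤
    j<k : suc j ≤ k
    j<k = ℕₚ.≤-trans (ℕₚ.m≤m+n (suc j) (length u)) j+u≤k
    cell-text : encode-Term (op {k} (base (cell (letter a))) (datum (suc j) ∷ [])) ≡
                𝐟 ∷ encode-ℕ (toℕ (code a)) ++ 𝐟 ∷ encode-ℕ (L + suc j)
    cell-text = trans (encode-op {k} (base (cell (letter a))) (datum (suc j) ∷ []))
      (cong₂ (λ i t → 𝐟 ∷ encode-ℕ i ++ t) (other-index-cell a)
        (trans (Listₚ.++-identityʳ _) (encode-datum {k} j<k)))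
    tail-text : toWord (encode-ℕ (toℕ (code a)) ++ 𝐟 ∷ encode-ℕ (L + suc j) ++ rest) ≡
                rhs-text (toWord (a ∷ u)) (L + j)
    tail-text = begin-≡
      toWord (encode-ℕ (toℕ (code a)) ++ 𝐟 ∷ encode-ℕ (L + suc j) ++ rest)
        ≡⟨ toWord-numeral (toℕ (code a)) _ ⟩
      𝟏 ^ toℕ (code a) ◃ (letter 𝐞 ∷ letter 𝐟 ∷ toWord (encode-ℕ (L + suc j) ++ rest))
        ≡⟨ cong (λ u → 𝟏 ^ toℕ (code a) ◃ (letter 𝐞 ∷ letter 𝐟 ∷ u)) (toWord-numeral (L + suc j) rest) ⟩
      𝟏 ^ toℕ (code a) ◃ (letter 𝐞 ∷ letter 𝐟 ∷ (𝟏 ^ (L + suc j) ◃ (letter 𝐞 ∷ toWord rest)))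
        ≡⟨ cong (λ u → 𝟏 ^ toℕ (code a) ◃ (letter 𝐞 ∷ letter 𝐟 ∷ (𝟏 ^ (L + suc j) ◃ (letter 𝐞 ∷ u))))
                (quotation-encoding u (suc j) j+u≤k) ⟩
      𝟏 ^ toℕ (code a) ◃ (letter 𝐞 ∷ letter 𝐟 ∷ (𝟏 ^ (L + suc j) ◃ (letter 𝐞 ∷ quotation-text (toWord u) (L + suc j))))
        ≡⟨ cong (λ i → 𝟏 ^ toℕ (code a) ◃ (letter 𝐞 ∷ letter 𝐟 ∷ (𝟏 ^ i ◃ (letter 𝐞 ∷ quotation-text (toWord u) i))))
                (ℕₚ.+-suc L j) ⟩
      rhs-text (toWord (a ∷ u)) (L + j) ∎

  -- Arity zero is spelled `𝐞`, so the letters inserted by `pad` are the arities of the constants c₁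
  -- to cₖ.
  encode-zeros : ∀ n u → toWord (concatMap encode-ℕ (replicate n 0) ++ u) ≡ 𝐞 ^ n ◃ toWord u
  encode-zeros zero    u = refl
  encode-zeros (suc n) u = cong (letter 𝐞 ∷_) (encode-zeros n u)

  -- The quine. The arities up to c₀ and the base rules are literal copies of the quote; the
  -- inserted zeros, one per quoted letter, and the printed chain are exactly what the quote omits.
  own-text-correct : own-text ≡ toWord (encode R)
  own-text-correct = begin-≡
    copied (toWord (A ++ base-rules-text)) 0
      ≡⟨ copied-signature base-arities base-rules-text 0 ⟩
    toWord A ++ copied (toWord base-rules-text) (length base-arities + 0)
      ≡⟨ cong (λ i → toWord A ++ copied (toWord base-rules-text) i) length-base-arities ⟩
    toWord A ++ 𝐞 ^ length quoted-word ◃ (toWord base-rules-text ++ quotation-text quoted-word (length ops))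
      ≡⟨ cong₂ (λ i u → toWord A ++ 𝐞 ^ i ◃ u) (Listₚ.length-map letter base-text) rules-text ⟩
    toWord A ++ 𝐞 ^ k ◃ toWord (concatMap encode-Rule (rules R))
      ≡⟨ cong (toWord A ++_) (sym (encode-zeros k _)) ⟩
    toWord A ++ toWord (Z ++ concatMap encode-Rule (rules R))
      ≡⟨ sym (toWord-++ A _) ⟩
    toWord (A ++ Z ++ concatMap encode-Rule (rules R))
      ≡⟨ cong toWord (sym (Listₚ.++-assoc A Z _)) ⟩
    toWord ((A ++ Z) ++ concatMap encode-Rule (rules R))
      ≡⟨ cong (λ u → toWord (u ++ concatMap encode-Rule (rules R))) signature-text ⟩
    toWord (encode R) ∎
    where
    A = concatMap encode-ℕ base-arities
    Z = concatMap encode-ℕ (replicate k 0)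
    signature-text : A ++ Z ≡ concatMap encode-ℕ (signature R)
    signature-text =
      trans (sym (Listₚ.concatMap-++ encode-ℕ base-arities (replicate k 0)))
            (cong (concatMap encode-ℕ) (Listₚ.++-assoc (map op-arity ops) (0 ∷ []) (replicate k 0)))
    rules-text : toWord base-rules-text ++ quotation-text quoted-word (length ops) ≡
                 toWord (concatMap encode-Rule (rules R))
    rules-text = begin-≡
      toWord base-rules-text ++ quotation-text quoted-word (length ops)
        ≡⟨ cong (λ i → toWord base-rules-text ++ quotation-text quoted-word i) (sym (ℕₚ.+-identityʳ (length ops))) ⟩
      toWord base-rules-text ++ quotation-text quoted-word (length ops + 0)
        ≡⟨ cong (toWord base-rules-text ++_) (sym (quotation-encoding base-text 0 ℕₚ.≤-refl)) ⟩
      toWord base-rules-text ++ toWord (concatMap encode-Rule (quotation k base-text 0))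
        ≡⟨ sym (toWord-++ base-rules-text _) ⟩
      toWord (base-rules-text ++ concatMap encode-Rule (quotation k base-text 0))
        ≡⟨ cong (λ u → toWord (u ++ concatMap encode-Rule (quotation k base-text 0))) (sym (encode-base-rules k)) ⟩
      toWord (concatMap encode-Rule (base-rules k) ++ concatMap encode-Rule (quotation k base-text 0))
        ≡⟨ cong toWord (sym (Listₚ.concatMap-++ encode-Rule (base-rules k) (quotation k base-text 0))) ⟩
      toWord (concatMap encode-Rule (rules R)) ∎

  -- The diagonal argument.

  input-tape : ∀ u → input u ≡ tape-at right [] (toWord u)
  input-tape []      = refl
  input-tape (a ∷ u) = refl

  start-tape : input (encode R) ≡ tape-at right [] own-text
  start-tape = trans (input-tape (encode R)) (cong (tape-at right []) (sym own-text-correct))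

  deterministic : ∀ {q t} → HaltsFrom M q t true → ¬ HaltsFrom M q t false
  deterministic (stop eq) (stop eq′) with () ← trans (sym eq) eq′
  deterministic (stop eq) (step eq′ _) with () ← trans (sym eq) eq′
  deterministic (step eq _) (stop eq′) with () ← trans (sym eq) eq′
  deterministic (step eq h) (step eq′ h′) with refl ← trans (sym eq) eq′ = deterministic h h′

  -- If the system were `UN⁼`, then `M` would accept it and thereby refute this. So it is not `UN⁼`
  -- and `M` rejects it; being deterministic, `M` does not accept it, which makes the system `UN⁼`
  -- after all.
  not-decided : ¬ DecidesOn M (encode R) (UN⁼ R)
  not-decided (accepts , rejects) = ¬un (UN⁼-unless-accepting λ h → deterministic (back h) (rejects ¬un))
    where
    ¬un : ¬ UN⁼ R
    ¬un un = ¬UN⁼-if-accepting copies-base-text (≡-subst (Accepting start) start-tape (accepts un)) un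
    back : Accepts → Answers M (encode R) true
    back = ≡-subst (Accepting start) (sym start-tape)

theorem4p11 : ¬ (Σ TuringMachine λ M →
    (R : TRS) → Linear R → RightFlat R → LeftHeight≤ 2 R →
    DecidesOn M (encode R) (UN⁼ R))
theorem4p11 (M , decides) =
  not-decided (decides (system base-text) (All.map proj₁ restricted)
    (All.map (proj₁ ∘ proj₂) restricted) (All.map (proj₂ ∘ proj₂) restricted))
  where
  open Reduction M
  restricted = system-restricted base-text
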